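{- $f_3(5,4)=\dfrac{16}{7}=\rho_3(G^*)$.
   Context: All graphs are finite and simple. For integers $\Delta,\omega$, let $\mathcal{G}(\Delta,\omega)$ be the class of graphs $G$ with maximum degree $\Delta(G)\le\Delta$ and clique number $\omega(G)\le\omega$. For a graph $G$, $k_t(G)$ denotes the number of copies of $K_t$ in $G$, and $\rho_t(G)=k_t(G)/|V(G)|$. For a positive integer $n$ let $k_t(n,\Delta,\omega)=\max\{k_t(G): |V(G)|=n,\ G\in\mathcal{G}(\Delta,\omega)\}$, and define $f_t(\Delta,\omega)=\lim_{n\to\infty}k_t(n,\Delta,\omega)/n$ (this limit exists and equals $\sup_{n}k_t(n,\Delta,\omega)/n$). The graph $G^*$ is obtained from $K_6$ by deleting a matching of two edges $wx$ and $yz$, and then adding a new vertex adjacent exactly to $w,x,y,z$; it has 7 vertices. -}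

module Defs where

open import Data.Bool using (Bool; true; false; _∧_; _∨_; not; if_then_else_)
open import Data.Nat using (ℕ; zero; suc; _≤_; _≡ᵇ_)
open import Data.Fin using (Fin; toℕ)
open import Data.Fin.Subset using (Subset; ∣_∣)
open import Data.Vec using ([]; _∷_; lookup)
open import Data.List using (List; []; _∷_; _++_; map; allFin; filter; length; concatMap)
open import Data.Nat.ListAction using (sum)
open import Data.Bool.ListAction using (and)
open import Relation.Nullary.Decidable using (⌊_⌋)
open import Data.Fin using (_≟_)
open import Relation.Binary.PropositionalEquality using (_≡_; refl)
open import Data.Bool.Properties using (T?)

record Graph (n : ℕ) : Set where
  field
    adj    : Fin n → Fin n → Bool
    sym    : ∀ i j → adj i j ≡ adj j i
    irrefl : ∀ i → adj i i ≡ false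
open Graph public

degree : ∀ {n} → Graph n → Fin n → ℕ
degree {n} G i = sum (map (λ j → if adj G i j then 1 else 0) (allFin n))

MaxDegree≤ : ∀ {n} → Graph n → ℕ → Set
MaxDegree≤ G Δ = ∀ i → degree G i ≤ Δ

isCliqueᵇ : ∀ {n} → Graph n → Subset n → Bool
isCliqueᵇ {n} G S =
  and (concatMap (λ i → map (λ j →
        not (lookup S i ∧ lookup S j ∧ not ⌊ i ≟ j ⌋) ∨ adj G i j)
      (allFin n)) (allFin n))

CliqueNumber≤ : ∀ {n} → Graph n → ℕ → Set
CliqueNumber≤ G ω = ∀ S → isCliqueᵇ G S ≡ true → ∣ S ∣ ≤ ω

InClass : ∀ {n} → Graph n → ℕ → ℕ → Set
InClass G Δ ω = MaxDegree≤ G Δ × CliqueNumber≤ G ω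
  where open import Data.Product using (_×_)

allSubsets : ∀ n → List (Subset n)
allSubsets zero = [] ∷ []
allSubsets (suc n) = map (true ∷_) (allSubsets n) ++ map (false ∷_) (allSubsets n)

k : ℕ → ∀ {n} → Graph n → ℕ
k t {n} G = length (filter (λ S → T? ((∣ S ∣ ≡ᵇ t) ∧ isCliqueᵇ G S)) (allSubsets n))

-- The graph G*: vertices 0..5 form K6 minus the matching {01, 23}
-- (w=0, x=1, y=2, z=3), and vertex 6 is adjacent exactly to 0,1,2,3.
-- Ordered non-edges between distinct vertices (listed one direction only):
nonEdge* : ℕ → ℕ → Bool
nonEdge* 0 1 = true
nonEdge* 2 3 = true
nonEdge* 4 6 = true
nonEdge* 5 6 = true
nonEdge* _ _ = false

adjℕ* : ℕ → ℕ → Bool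
adjℕ* a b = not (a ≡ᵇ b) ∧ not (nonEdge* a b ∨ nonEdge* b a)

private
  ≡ᵇ-sym : ∀ a b → (a ≡ᵇ b) ≡ (b ≡ᵇ a)
  ≡ᵇ-sym zero zero = refl
  ≡ᵇ-sym zero (suc b) = refl
  ≡ᵇ-sym (suc a) zero = refl
  ≡ᵇ-sym (suc a) (suc b) = ≡ᵇ-sym a b

  ≡ᵇ-refl : ∀ a → (a ≡ᵇ a) ≡ true
  ≡ᵇ-refl zero = refl
  ≡ᵇ-refl (suc a) = ≡ᵇ-refl a

  adjℕ*-sym : ∀ a b → adjℕ* a b ≡ adjℕ* b a
  adjℕ*-sym a b rewrite ≡ᵇ-sym a b | Data.Bool.Properties.∨-comm (nonEdge* a b) (nonEdge* b a) = refl

  adjℕ*-irrefl : ∀ a → adjℕ* a a ≡ false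
  adjℕ*-irrefl a rewrite ≡ᵇ-refl a = refl

Gstar : Graph 7
Gstar = record
  { adj = λ i j → adjℕ* (toℕ i) (toℕ j)
  ; sym = λ i j → adjℕ*-sym (toℕ i) (toℕ j)
  ; irrefl = λ i → adjℕ*-irrefl (toℕ i)
  }

{-# OPTIONS --safe #-}

-- Let t(v) be the number of edges inside N(v), so that Σ t(v) = 3 k₃(G); the claim is that the
-- average of t is at most 48/7.  In 𝒢(5,4) always t ≤ 8, and t(v) = 8 forces N(v) = K₁,₂,₂; such v
-- come in adjacent twins sharing a closed neighbourhood.  Discharge the excess 7 t(v) − 48: a
-- vertex with t = 8 sends 2 to each neighbour with t ≤ 7, and a vertex with t = 7 sends to each
-- neighbour with t ≤ 5 either 5 or 1, according to whether it has a neighbour with t = 8.  Nobody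
-- is left with positive charge: a vertex with t ∈ {6,7} has at most two neighbours with t = 8, a
-- vertex with t = 7 has a neighbour with t ≤ 5, only vertices with t ≤ 4 receive fives, and a
-- vertex has at most t senders, because a sender shares at least two neighbours with the receiver.

module Submission where

open import Defs
open import Data.Bool using (Bool; true; false; _∧_; _∨_; not; if_then_else_; T)
open import Data.Bool using () renaming (_≟_ to _≟ᵇ_)
open import Data.Bool.ListAction using (and)
open import Data.Bool.Properties using (T?; ∧-assoc; ∧-comm; ∧-zeroʳ; T-≡; T-∧; ¬-not)
open import Data.Empty using () renaming (⊥ to Empty; ⊥-elim to absurd)
open import Data.Fin using (Fin; zero; suc; _≟_)
open import Data.Fin.Properties as Finₚ using (all?)
open import Data.Fin.Subset using (Subset; ∣_∣; ⊥)
open import Data.Fin.Subset.Properties using (∣⊥∣≡0; anySubset?)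
open import Data.List using (List; []; _∷_; [_]; _++_; map; allFin; filterᵇ; length; foldr)
open import Data.List.Membership.Propositional using (_∈_; _∉_; find; lose)
open import Data.List.Membership.Propositional.Properties
  using (∈-∃++; ∈-map⁺; ∈-map⁻; ∈-concatMap⁺; ∈-concatMap⁻; ∈-allFin; ∈-filter⁺; ∈-filter⁻)
open import Data.List.Properties using (map-tabulate; filter-++; length-++; length-tabulate)
open import Data.List.Relation.Binary.Permutation.Propositional
  using (_↭_; refl; prep; swap; trans; ↭-sym; ↭-trans; ↭⇒↭ₛ)
open import Data.List.Relation.Binary.Permutation.Propositional.Properties
  using (map⁺; ∈-resp-↭; All-resp-↭; shift; ↭-length)
import Data.List.Relation.Binary.Permutation.Setoid.Properties as Permₛ
open import Data.List.Relation.Unary.All as All using (All; []; _∷_)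
open import Data.List.Relation.Unary.AllPairs as AllPairs using (AllPairs; []; _∷_)
open import Data.List.Relation.Unary.Any using (Any; here; there; any?)
open import Data.List.Relation.Unary.Unique.Propositional using (Unique)
import Data.List.Relation.Unary.Unique.Propositional.Properties as Uniqueₚ
open import Data.Nat using (ℕ; zero; suc; pred; _+_; _*_; _≤_; _<_; z≤n; s≤s; _≤?_; _<?_)
open import Data.Nat.ListAction using (sum)
open import Data.Nat.ListAction.Properties using (sum-↭)
open import Data.Nat.Properties hiding (_≟_)
open import Data.Nat.Properties using () renaming (_≟_ to _≟ℕ_)
open import Data.Nat.Tactic.RingSolver using (solve-∀)
open import Data.Product using (_×_; _,_; ∃; ∃₂; proj₁; proj₂)
open import Data.Sum using (_⊎_; inj₁; inj₂)
open import Data.Unit using (tt)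
open import Data.Vec using ([]; _∷_; lookup; _[_]≔_)
open import Data.Vec.Properties using (lookup∘update′; lookup-replicate)
open import Function using (_∘_; Equivalence)
open import Relation.Binary.PropositionalEquality
  using (_≡_; _≢_; refl; cong; cong₂; subst; setoid; module ≡-Reasoning)
  renaming (sym to ≡-sym; trans to ≡-trans)
open import Relation.Nullary using (¬_; Dec; does; yes; no; contradiction)
open import Relation.Nullary.Decidable
  using (⌊_⌋; toWitness; toWitnessFalse; ¬?; _→-dec_; _×-dec_; _⊎-dec_)

private variable
  X Y : Set

-- Finite sums over lists.

ι : Bool → ℕ
ι b = if b then 1 else 0

ι-∧ : ∀ a b → ι (a ∧ b) ≡ ι a * ι b
ι-∧ true  b = ≡-sym (+-identityʳ (ι b))
ι-∧ false b = refl

Σ[_] : List X → (X → ℕ) → ℕ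
Σ[ L ] f = sum (map f L)

Σ-cong : ∀ (L : List X) {f g : X → ℕ} → (∀ x → f x ≡ g x) → Σ[ L ] f ≡ Σ[ L ] g
Σ-cong []      h = refl
Σ-cong (x ∷ L) h = cong₂ _+_ (h x) (Σ-cong L h)

Σ-mono : ∀ (L : List X) {f g : X → ℕ} → (∀ {x} → x ∈ L → f x ≤ g x) → Σ[ L ] f ≤ Σ[ L ] g
Σ-mono []      h = z≤n
Σ-mono (x ∷ L) h = +-mono-≤ (h (here refl)) (Σ-mono L (h ∘ there))

Σ-const : ∀ (L : List X) c → Σ[ L ] (λ _ → c) ≡ length L * c
Σ-const []      c = refl
Σ-const (_ ∷ L) c = cong (c +_) (Σ-const L c)

Σ-+ : ∀ (L : List X) (f g : X → ℕ) → Σ[ L ] (λ x → f x + g x) ≡ Σ[ L ] f + Σ[ L ] g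
Σ-+ []      f g = refl
Σ-+ (x ∷ L) f g = ≡-trans (cong (f x + g x +_) (Σ-+ L f g)) (shuffle (f x) (g x) _ _)
  where
  shuffle : ∀ a b c d → (a + b) + (c + d) ≡ (a + c) + (b + d)
  shuffle = solve-∀

Σ-* : ∀ c (L : List X) (f : X → ℕ) → Σ[ L ] (λ x → c * f x) ≡ c * Σ[ L ] f
Σ-* c []      f = ≡-sym (*-zeroʳ c)
Σ-* c (x ∷ L) f = ≡-trans (cong (c * f x +_) (Σ-* c L f)) (≡-sym (*-distribˡ-+ c (f x) _))

Σ-swap : ∀ (L : List X) (M : List Y) (f : X → Y → ℕ) →
  Σ[ L ] (λ x → Σ[ M ] (f x)) ≡ Σ[ M ] (λ y → Σ[ L ] (λ x → f x y))
Σ-swap []      M f = ≡-sym (≡-trans (Σ-const M 0) (*-zeroʳ (length M)))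
Σ-swap (x ∷ L) M f =
  ≡-trans (cong (Σ[ M ] (f x) +_) (Σ-swap L M f)) (≡-sym (Σ-+ M (f x) _))

Σ-↭ : ∀ {L M : List X} (f : X → ℕ) → L ↭ M → Σ[ L ] f ≡ Σ[ M ] f
Σ-↭ f p = sum-↭ (map⁺ f p)

Σ-filterᵇ : ∀ (p : X → Bool) (L : List X) (f : X → ℕ) →
  Σ[ filterᵇ p L ] f ≡ Σ[ L ] (λ x → ι (p x) * f x)
Σ-filterᵇ p []      f = refl
Σ-filterᵇ p (x ∷ L) f with p x
... | true  = cong₂ _+_ (≡-sym (+-identityʳ (f x))) (Σ-filterᵇ p L f)
... | false = Σ-filterᵇ p L f

Σ-++ : ∀ (L M : List X) f → Σ[ L ++ M ] f ≡ Σ[ L ] f + Σ[ M ] f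
Σ-++ []      M f = refl
Σ-++ (x ∷ L) M f = ≡-trans (cong (f x +_) (Σ-++ L M f)) (≡-sym (+-assoc (f x) _ _))

Σ-zero : ∀ {L : List X} {f} → All (λ x → f x ≡ 0) L → Σ[ L ] f ≡ 0
Σ-zero []        = refl
Σ-zero (h ∷ hs) = cong₂ _+_ h (Σ-zero hs)

Σ-member : ∀ {L : List X} (f : X → ℕ) {x} → x ∈ L → f x ≤ Σ[ L ] f
Σ-member f (here refl) = m≤m+n _ _
Σ-member f (there x∈L) = m≤n⇒m≤o+n _ (Σ-member f x∈L)

Σ-allFin-suc : ∀ {n} (f : Fin (suc n) → ℕ) →
  Σ[ allFin (suc n) ] f ≡ f zero + Σ[ allFin n ] (f ∘ suc)
Σ-allFin-suc f = cong (λ l → f zero + sum l)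
  (≡-trans (map-tabulate suc f) (≡-sym (map-tabulate (λ i → i) (f ∘ suc))))

-- Counting cliques by recursion on the vertices.

-- Recursion on the first vertex, as in allSubsets; P accumulates adjacency to the vertices already chosen.
cliques : ℕ → ∀ {n} → (Fin n → Fin n → Bool) → (Fin n → Bool) → ℕ
cliques zero            A P = 1
cliques (suc t) {zero}  A P = 0
cliques (suc t) {suc n} A P =
  ι (P zero) * cliques t (λ i j → A (suc i) (suc j)) (λ i → P (suc i) ∧ A zero (suc i))
  + cliques (suc t) (λ i j → A (suc i) (suc j)) (P ∘ suc)

cliques-cong : ∀ t {n} (A : Fin n → Fin n → Bool) {P Q : Fin n → Bool} →
  (∀ i → P i ≡ Q i) → cliques t A P ≡ cliques t A Q
cliques-cong zero            A h = refl
cliques-cong (suc t) {zero}  A h = refl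
cliques-cong (suc t) {suc n} A h = cong₂ _+_
  (cong₂ _*_ (cong ι (h zero)) (cliques-cong t _ (λ i → cong (_∧ A zero (suc i)) (h (suc i)))))
  (cliques-cong (suc t) _ (h ∘ suc))

-- Double counting: every clique with `suc t` vertices inside `P` is counted once for each of its
-- vertices taken as root.
cliques-rooted : ∀ t {n} (A : Fin n → Fin n → Bool) →
  (∀ i j → A i j ≡ A j i) → (∀ i → A i i ≡ false) → ∀ P →
  suc t * cliques (suc t) A P ≡ Σ[ allFin n ] (λ i → ι (P i) * cliques t A (λ j → P j ∧ A i j))
cliques-rooted t {zero}  A As Ai P = *-zeroʳ t
cliques-rooted t {suc n} A As Ai P = ≡-sym (≡-trans (Σ-allFin-suc (λ i → ι (P i) * cliques t A (λ j → P j ∧ A i j))) (≡-trans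
    (cong₂ _+_ (cong (ι (P zero) *_) (atZero t)) (atSuc t))
    (collect t (ι (P zero) * cliques t A′ Q) (cliques (suc t) A′ P′))))
  where
  A′ : Fin n → Fin n → Bool
  A′ i j = A (suc i) (suc j)
  P′ Q : Fin n → Bool
  P′ = P ∘ suc
  Q i = P′ i ∧ A zero (suc i)
  IH : ∀ t P → suc t * cliques (suc t) A′ P
             ≡ Σ[ allFin n ] (λ i → ι (P i) * cliques t A′ (λ j → P j ∧ A′ i j))
  IH t = cliques-rooted t A′ (λ i j → As (suc i) (suc j)) (Ai ∘ suc)
  collect : ∀ t a b → a + (t * a + suc t * b) ≡ suc t * (a + b)
  collect = solve-∀
  -- Vertex zero is not its own neighbour, so a clique completing the root zero lies among the later
  -- vertices.
  atZero : ∀ t → cliques t A (λ j → P j ∧ A zero j) ≡ cliques t A′ Q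
  atZero zero = refl
  atZero (suc t) rewrite Ai zero | ∧-zeroʳ (P zero) = refl
  regroup : ∀ a p b c d → a * (p * b * c + d) ≡ p * (a * b * c) + a * d
  regroup = solve-∀
  pull : ∀ p t c d → p * (suc t * c) + d ≡ suc t * (p * c) + d
  pull = solve-∀
  -- The roots other than zero: a clique through vertex zero has `t` of them, a clique avoiding it
  -- has `suc t`.
  atSuc : ∀ t → Σ[ allFin n ] (λ i → ι (P′ i) * cliques t A (λ j → P j ∧ A (suc i) j))
              ≡ t * (ι (P zero) * cliques t A′ Q) + suc t * cliques (suc t) A′ P′
  atSuc zero    = ≡-sym (IH 0 P′)
  atSuc (suc t) = ≡-trans (Σ-cong (allFin n) step) (≡-trans (Σ-+ (allFin n) _ _) (≡-trans
    (cong₂ _+_ (≡-trans (Σ-* (ι (P zero)) (allFin n) _) (cong (ι (P zero) *_) (≡-sym (IH t Q))))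
               (≡-sym (IH (suc t) P′)))
    (pull (ι (P zero)) t (cliques (suc t) A′ Q) _)))
    where
    step : ∀ i → ι (P′ i) * cliques (suc t) A (λ j → P j ∧ A (suc i) j)
               ≡ ι (P zero) * (ι (Q i) * cliques t A′ (λ j → Q j ∧ A′ i j))
                 + ι (P′ i) * cliques (suc t) A′ (λ j → P′ j ∧ A′ i j)
    step i
      rewrite ι-∧ (P zero) (A (suc i) zero) | ι-∧ (P′ i) (A zero (suc i)) | As (suc i) zero
            | cliques-cong t A′ {λ j → (P′ j ∧ A′ i j) ∧ A zero (suc j)} {λ j → Q j ∧ A′ i j}
                (λ j → ≡-trans (∧-assoc (P′ j) _ _)
                   (≡-trans (cong (P′ j ∧_) (∧-comm (A′ i j) _)) (≡-sym (∧-assoc (P′ j) _ _))))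
      = regroup (ι (P′ i)) (ι (P zero)) (ι (A zero (suc i))) _ _

length-filterᵇ-map : ∀ (p : Y → Bool) (f : X → Y) L →
  length (filterᵇ p (map f L)) ≡ length (filterᵇ (p ∘ f) L)
length-filterᵇ-map p f []      = refl
length-filterᵇ-map p f (x ∷ L) with p (f x)
... | true  = cong suc (length-filterᵇ-map p f L)
... | false = length-filterᵇ-map p f L

filterᵇ-none : ∀ (p : X → Bool) L → (∀ x → ¬ T (p x)) → length (filterᵇ p L) ≤ 0
filterᵇ-none p []      h = z≤n
filterᵇ-none p (x ∷ L) h with p x in eq
... | true  = contradiction (Equivalence.from T-≡ eq) (h x)
... | false = filterᵇ-none p L h

count-split : ∀ {n} (p : Subset (suc n) → Bool) → length (filterᵇ p (allSubsets (suc n)))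
  ≡ length (filterᵇ (p ∘ (true ∷_)) (allSubsets n)) + length (filterᵇ (p ∘ (false ∷_)) (allSubsets n))
count-split {n} p rewrite filter-++ (T? ∘ p) (map (true ∷_) (allSubsets n)) (map (false ∷_) (allSubsets n))
  | length-++ (filterᵇ p (map (true ∷_) (allSubsets n))) {filterᵇ p (map (false ∷_) (allSubsets n))}
  | length-filterᵇ-map p (true ∷_) (allSubsets n) | length-filterᵇ-map p (false ∷_) (allSubsets n) = refl

CliqueIn : ∀ {n} → (Fin n → Fin n → Bool) → (Fin n → Bool) → Subset n → Set
CliqueIn A P S = (∀ i → lookup S i ≡ true → P i ≡ true)
  × (∀ i j → lookup S i ≡ true → lookup S j ≡ true → i ≢ j → A i j ≡ true)

CliqueIn-tail : ∀ {n b} {A : Fin (suc n) → Fin (suc n) → Bool} {P S} → CliqueIn A P (b ∷ S) →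
  CliqueIn (λ i j → A (suc i) (suc j)) (P ∘ suc) S
CliqueIn-tail (sub , adj) =
  (λ i → sub (suc i)) , (λ i j i∈ j∈ i≢j → adj (suc i) (suc j) i∈ j∈ (i≢j ∘ Finₚ.suc-injective))

-- Only an upper bound on `k 3` is wanted, so an inequality suffices. The predicate `p` is arbitrary
-- because the induction replaces it by its restrictions to subsets that contain, or avoid, the
-- first vertex.
count≤cliques : ∀ t {n} (A : Fin n → Fin n → Bool) (P : Fin n → Bool) (p : Subset n → Bool) →
  (∀ S → T (p S) → ∣ S ∣ ≡ t × CliqueIn A P S) → length (filterᵇ p (allSubsets n)) ≤ cliques t A P
count≤cliques zero {zero} A P p h with p []
... | true  = ≤-refl
... | false = z≤n
count≤cliques (suc t) {zero} A P p h = filterᵇ-none p (allSubsets zero) λ { [] pS → 0≢1+n (proj₁ (h [] pS)) }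
count≤cliques zero {suc n} A P p h rewrite count-split p = +-mono-≤
  (filterᵇ-none (p ∘ (true ∷_)) (allSubsets n) (λ S pS → 1+n≢0 (proj₁ (h (true ∷ S) pS))))
  (count≤cliques zero _ (P ∘ suc) (p ∘ (false ∷_))
    (λ S pS → proj₁ (h (false ∷ S) pS) , CliqueIn-tail {A = A} {P} (proj₂ (h (false ∷ S) pS))))
count≤cliques (suc t) {suc n} A P p h rewrite count-split p = +-mono-≤ with0
  (count≤cliques (suc t) _ (P ∘ suc) (p ∘ (false ∷_))
    (λ S pS → proj₁ (h (false ∷ S) pS) , CliqueIn-tail {A = A} {P} (proj₂ (h (false ∷ S) pS))))
  where
  with0 : length (filterᵇ (p ∘ (true ∷_)) (allSubsets n)) ≤ ι (P zero) * _
  with0 with P zero in P0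
  ... | false = filterᵇ-none (p ∘ (true ∷_)) (allSubsets n) λ S pS →
    contradiction (≡-trans (≡-sym P0) (proj₁ (proj₂ (h (true ∷ S) pS)) zero refl)) λ ()
  ... | true = ≤-trans (count≤cliques t _ _ (p ∘ (true ∷_)) λ S pS →
      let (sz , cl) = h (true ∷ S) pS
          (sub , adj) = CliqueIn-tail {A = A} {P} cl
      in suc-injective sz
       , (λ i i∈ → cong₂ _∧_ (sub i i∈) (proj₂ cl zero (suc i) refl i∈ λ ()))
       , adj)
    (≤-reflexive (≡-sym (+-identityʳ _)))

-- The boolean clique test in terms of adjacency.

and-elim : ∀ {bs b} → and bs ≡ true → b ∈ bs → b ≡ true
and-elim {true ∷ bs} h (here refl) = refl
and-elim {true ∷ bs} h (there b∈)  = and-elim h b∈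

and-intro : ∀ bs → (∀ {b} → b ∈ bs → b ≡ true) → and bs ≡ true
and-intro []       h = refl
and-intro (b ∷ bs) h = cong₂ _∧_ (h (here refl)) (and-intro bs (h ∘ there))

module _ {n} (G : Graph n) (S : Subset n) where
  private
    entry : Fin n → Fin n → Bool
    entry i j = not (lookup S i ∧ lookup S j ∧ not ⌊ i ≟ j ⌋) ∨ adj G i j

  isCliqueᵇ⇒adj : isCliqueᵇ G S ≡ true →
    ∀ i j → lookup S i ≡ true → lookup S j ≡ true → i ≢ j → adj G i j ≡ true
  isCliqueᵇ⇒adj h i j i∈ j∈ i≢j with and-elim {b = entry i j} h
    (∈-concatMap⁺ _ (lose (∈-allFin i) (∈-map⁺ _ (∈-allFin j))))
  ... | e with i ≟ j
  ...   | yes i≡j = contradiction i≡j i≢j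
  ...   | no  _ rewrite i∈ | j∈ = e

  adj⇒isCliqueᵇ : (∀ i j → lookup S i ≡ true → lookup S j ≡ true → i ≢ j → adj G i j ≡ true) →
    isCliqueᵇ G S ≡ true
  adj⇒isCliqueᵇ h = and-intro _ λ b∈ → entries (find (∈-concatMap⁻ _ b∈))
    where
    entry-true : ∀ i j → entry i j ≡ true
    entry-true i j with lookup S i in i∈ | lookup S j in j∈ | i ≟ j
    ... | false | _     | _       = refl
    ... | true  | false | _       = refl
    ... | true  | true  | yes _   = refl
    ... | true  | true  | no  i≢j = h i j i∈ j∈ i≢j
    entries : ∀ {b} → ∃ (λ i → i ∈ allFin n × b ∈ map (entry i) (allFin n)) → b ≡ true
    entries (i , _ , b∈) with j , _ , refl ← ∈-map⁻ (entry i) b∈ = entry-true i j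

-- Rooting a triangle three times in succession orders its vertices, which explains the factor 6 =
-- 3!.
triangles≤ : ∀ {n} (G : Graph n) → 6 * k 3 G ≤ Σ[ allFin n ] λ v →
  Σ[ allFin n ] λ x → ι (adj G v x) * Σ[ allFin n ] λ y → ι (adj G v y) * ι (adj G x y)
triangles≤ {n} G = ≤-trans
  (*-monoʳ-≤ 6 (count≤cliques 3 (adj G) (λ _ → true) _ λ S pS →
    let (sz , cl) = Equivalence.to T-∧ pS
    in ≡ᵇ⇒≡ ∣ S ∣ 3 sz , (λ _ _ → refl) , isCliqueᵇ⇒adj G S (Equivalence.to T-≡ cl)))
  (≤-reflexive (≡-trans (*-assoc 2 3 (cliques 3 (adj G) _)) (≡-trans
    (cong (2 *_) (rooted 2 (λ _ → true)))
    (≡-trans (≡-sym (Σ-* 2 (allFin n) _)) (Σ-cong (allFin n) λ v →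
      ≡-trans (cong (2 *_) (*-identityˡ (cliques 2 (adj G) (adj G v)))) (≡-trans (rooted 1 (adj G v))
      (Σ-cong (allFin n) λ x → cong (ι (adj G v x) *_) (≡-trans (≡-sym (*-identityˡ _)) (≡-trans
        (rooted 0 _) (Σ-cong (allFin n) λ y → ≡-trans (*-identityʳ _) (ι-∧ (adj G v y) _)))))))))))
  where
  rooted : ∀ t P → suc t * cliques (suc t) (adj G) P
    ≡ Σ[ allFin n ] (λ i → ι (P i) * cliques t (adj G) (λ j → P j ∧ adj G i j))
  rooted t = cliques-rooted t (adj G) (Graph.sym G) (Graph.irrefl G)

-- Pigeonhole, rearrangement of lists, case checks over booleans.

length-filterᵇ : ∀ (p : X → Bool) L → length (filterᵇ p L) ≡ Σ[ L ] (ι ∘ p)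
length-filterᵇ p []      = refl
length-filterᵇ p (x ∷ L) with p x
... | true  = cong suc (length-filterᵇ p L)
... | false = length-filterᵇ p L

some-above : ∀ k (L : List X) {f : X → ℕ} → k * length L < Σ[ L ] f → ∃ λ x → x ∈ L × k < f x
some-above k [] h = contradiction h (n≮0 {k * 0})
some-above k (x ∷ L) {f} h with k <? f x
... | yes k<fx = x , here refl , k<fx
... | no  k≮fx =
  let (y , y∈ , k<fy) = some-above k L (+-cancelˡ-< k _ _ (≤-trans
        (≤-reflexive (cong suc (≡-sym (*-suc k (length L))))) (≤-trans h (+-monoˡ-≤ _ (≮⇒≥ k≮fx)))))
  in y , there y∈ , k<fy

some-below : ∀ k (L : List X) {f : X → ℕ} → Σ[ L ] f < k * length L → ∃ λ x → x ∈ L × f x < k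
some-below k [] h = contradiction h (λ lt → n≮0 (≤-trans lt (≤-reflexive (*-zeroʳ k))))
some-below k (x ∷ L) {f} h with f x <? k
... | yes fx<k = x , here refl , fx<k
... | no  fx≮k =
  let (y , y∈ , fy<k) = some-below k L (+-cancelˡ-< k _ _ (≤-trans
        (s≤s (+-monoˡ-≤ _ (≮⇒≥ fx≮k))) (≤-trans h (≤-reflexive (*-suc k (length L))))))
  in y , there y∈ , fy<k

Unique-resp-↭ : ∀ {L M : List X} → L ↭ M → Unique L → Unique M
Unique-resp-↭ {X} p = Permₛ.Unique-resp-↭ (setoid X) (↭⇒↭ₛ p)

-- Pulls known members of a list to its front; with the degree bound this leaves few unknown
-- neighbours of a vertex.
extract : ∀ {L M : List X} → Unique L → All (_∈ M) L → ∃ λ R → M ↭ L ++ R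
extract {M = M} [] [] = M , refl
extract {L = x ∷ L} (x∉L ∷ uL) (x∈M ∷ L⊆M) with ∈-∃++ x∈M
... | ys , zs , refl =
  let (R , p) = extract uL (All.zipWith remove (x∉L , L⊆M))
  in R , ↭-trans (shift x ys zs) (prep x p)
  where
  remove : ∀ {y} → x ≢ y × y ∈ ys ++ [ x ] ++ zs → y ∈ ys ++ zs
  remove (x≢y , y∈) with ∈-resp-↭ (shift x ys zs) y∈
  ... | here y≡x  = contradiction (≡-sym y≡x) x≢y
  ... | there y∈′ = y∈′

∀ᵇ? : {P : Bool → Set} → (∀ b → Dec (P b)) → Dec (∀ b → P b)
∀ᵇ? P? with P? true | P? false
... | yes pt | yes pf = yes λ { true → pt ; false → pf }
... | no ¬pt | _      = no λ h → ¬pt (h true)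
... | yes _  | no ¬pf = no λ h → ¬pf (h false)

separate : ∀ (p : X → Bool) L → ∃₂ λ M N → L ↭ M ++ N
  × All (λ x → p x ≡ true) M × All (λ x → p x ≡ false) N × length M ≡ Σ[ L ] (ι ∘ p)
separate p [] = [] , [] , refl , [] , [] , refl
separate p (x ∷ L) with separate p L | p x in eq
... | M , N , σ , pM , ¬pN , len | true  = x ∷ M , N , prep x σ , eq ∷ pM , ¬pN , cong suc len
... | M , N , σ , pM , ¬pN , len | false =
  M , x ∷ N , ↭-trans (prep x σ) (↭-sym (shift x M N)) , pM , eq ∷ ¬pN , len

-- The discharging rule as a numerical function.

-- From a vertex with t = p to a neighbour with t = q; h tells whether the sender has a neighbour with t = 8.
charge : ℕ → Bool → ℕ → ℕ
charge p h q with p ≟ℕ 8 | q ≟ℕ 8 | p ≟ℕ 7 | q ≤? 5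
... | yes _ | yes _ | _     | _     = 0
... | yes _ | no  _ | _     | _     = 2
... | no  _ | _     | yes _ | yes _ = if h then 5 else 1
... | no  _ | _     | yes _ | no  _ = 0
... | no  _ | _     | no  _ | _     = 0

charge-from-8 : ∀ h {q} → q ≢ 8 → charge 8 h q ≡ 2
charge-from-8 h {q} q≢8 with q ≟ℕ 8
... | yes q≡8 = contradiction q≡8 q≢8
... | no  _   = refl

charge-from-7 : ∀ h {q} → q ≤ 5 → charge 7 h q ≡ (if h then 5 else 1)
charge-from-7 h {q} q≤5 with q ≟ℕ 8 | q ≤? 5
... | _ | yes _   = refl
... | _ | no  q≰5 = contradiction q≤5 q≰5

charge≤5 : ∀ p h q → charge p h q ≤ 5
charge≤5 p h q with p ≟ℕ 8 | q ≟ℕ 8 | p ≟ℕ 7 | q ≤? 5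
... | yes _ | yes _ | _     | _     = z≤n
... | yes _ | no  _ | _     | _     = m≤m+n 2 3
... | no  _ | _     | yes _ | no  _ = z≤n
... | no  _ | _     | no  _ | _     = z≤n
charge≤5 p true  q | no _ | _ | yes _ | yes _ = ≤-refl
charge≤5 p false q | no _ | _ | yes _ | yes _ = s≤s z≤n

-- The last hypothesis rules out the only case in which the charge is 5.
charge≤2 : ∀ p h q → (p ≡ 7 → q ≤ 5 → h ≡ true → Empty) → charge p h q ≤ 2
charge≤2 p h q ¬big with p ≟ℕ 8 | q ≟ℕ 8 | p ≟ℕ 7 | q ≤? 5
... | yes _ | yes _ | _     | _     = z≤n
... | yes _ | no  _ | _     | _     = ≤-refl
... | no  _ | _     | yes _ | no  _ = z≤n
... | no  _ | _     | no  _ | _     = z≤n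
charge≤2 p true  q ¬big | no _ | _ | yes p≡7 | yes q≤5 = absurd (¬big p≡7 q≤5 refl)
charge≤2 p false q ¬big | no _ | _ | yes _   | yes _   = s≤s z≤n

charge-light : ∀ {p} h q → p ≤ 6 → charge p h q ≡ 0
charge-light {p} h q p≤6 with p ≟ℕ 8 | q ≟ℕ 8 | p ≟ℕ 7 | q ≤? 5
... | yes refl | _ | _ | _ = contradiction p≤6 (<⇒≱ (m≤m+n 7 1))
... | no  _ | _ | yes refl | _ = contradiction p≤6 (<⇒≱ ≤-refl)
... | no  _ | _ | no  _ | _ = refl

charge-to-heavy : ∀ {p} h {q} → p ≢ 8 → 6 ≤ q → charge p h q ≡ 0
charge-to-heavy {p} h {q} p≢8 6≤q with p ≟ℕ 8 | q ≟ℕ 8 | p ≟ℕ 7 | q ≤? 5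
... | yes p≡8 | _ | _     | _       = contradiction p≡8 p≢8
... | no  _   | _ | yes _ | yes q≤5 = contradiction q≤5 (<⇒≱ 6≤q)
... | no  _   | _ | yes _ | no  _   = refl
... | no  _   | _ | no  _ | _       = refl

charge-to-8 : ∀ p h → charge p h 8 ≡ 0
charge-to-8 p h with p ≟ℕ 8 | p ≟ℕ 7
... | yes _ | _     = refl
... | no  _ | yes _ = refl
... | no  _ | no  _ = refl

-- Cliques and neighbour lists in a graph of the class.

module Discharging {n} (G : Graph n) (Δ≤5 : MaxDegree≤ G 5) (ω≤4 : CliqueNumber≤ G 4) where

  V : Set
  V = Fin n

  A : V → V → Bool
  A = adj G

  infix 4 _~_ _≁_
  _~_ _≁_ : V → V → Set
  x ~ y = A x y ≡ true
  x ≁ y = A x y ≡ false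

  ~-sym : ∀ {x y} → x ~ y → y ~ x
  ~-sym {x} {y} = ≡-trans (Graph.sym G y x)

  ≁-sym : ∀ {x y} → x ≁ y → y ≁ x
  ≁-sym {x} {y} = ≡-trans (Graph.sym G y x)

  ~×≁ : ∀ {x y} → x ~ y → x ≁ y → Empty
  ~×≁ x~y x≁y = contradiction (≡-trans (≡-sym x~y) x≁y) λ ()

  ~⇒≢ : ∀ {x y} → x ~ y → x ≢ y
  ~⇒≢ {x} x~x refl = ~×≁ x~x (irrefl G x)

  ~×≁⇒≢ : ∀ {v x y} → v ~ x → v ≁ y → x ≢ y
  ~×≁⇒≢ v~x v≁y refl = ~×≁ v~x v≁y

  -- The clique bound is stated for subsets, whereas the arguments below produce explicit lists of
  -- pairwise adjacent vertices.
  indicator : List V → Subset n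
  indicator = foldr (λ x S → S [ x ]≔ true) ⊥

  ∈-indicator : ∀ L {j} → lookup (indicator L) j ≡ true → j ∈ L
  ∈-indicator [] {j} h = contradiction (≡-trans (≡-sym h) (lookup-replicate j false)) λ ()
  ∈-indicator (x ∷ L) {j} h with j ≟ x
  ... | yes j≡x = here j≡x
  ... | no  j≢x = there (∈-indicator L (≡-trans (≡-sym (lookup∘update′ j≢x (indicator L) true)) h))

  ∣[]≔∣ : ∀ {m} (S : Subset m) x → lookup S x ≡ false → ∣ S [ x ]≔ true ∣ ≡ suc ∣ S ∣
  ∣[]≔∣ (false ∷ S) zero    h = refl
  ∣[]≔∣ (true  ∷ S) (suc x) h = cong suc (∣[]≔∣ S x h)
  ∣[]≔∣ (false ∷ S) (suc x) h = ∣[]≔∣ S x h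

  ∣indicator∣ : ∀ {L} → Unique L → ∣ indicator L ∣ ≡ length L
  ∣indicator∣ []                  = ∣⊥∣≡0 n
  ∣indicator∣ {x ∷ L} (x∉L ∷ uL) = ≡-trans
    (∣[]≔∣ (indicator L) x (¬-not λ x∈ → All.lookup x∉L (∈-indicator L x∈) refl))
    (cong suc (∣indicator∣ uL))

  AllPairs-~ : ∀ {L i j} → AllPairs _~_ L → i ∈ L → j ∈ L → i ≢ j → i ~ j
  AllPairs-~ (_ ∷ _)   (here refl) (here refl) i≢j = contradiction refl i≢j
  AllPairs-~ (x~L ∷ _) (here refl) (there j∈)  _   = All.lookup x~L j∈
  AllPairs-~ (x~L ∷ _) (there i∈)  (here refl) _   = ~-sym (All.lookup x~L i∈)
  AllPairs-~ (_ ∷ pL)  (there i∈)  (there j∈)  i≢j = AllPairs-~ pL i∈ j∈ i≢j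

  clique≤4 : ∀ {L} → AllPairs _~_ L → length L ≤ 4
  clique≤4 {L} pL = subst (_≤ 4) (∣indicator∣ (AllPairs.map ~⇒≢ pL)) (ω≤4 (indicator L)
    (adj⇒isCliqueᵇ G (indicator L) λ i j i∈ j∈ → AllPairs-~ pL (∈-indicator L i∈) (∈-indicator L j∈)))

  no-K₅ : ∀ {v w x y z} → AllPairs _~_ (v ∷ w ∷ x ∷ y ∷ z ∷ []) → Empty
  no-K₅ p with clique≤4 p
  ... | s≤s (s≤s (s≤s (s≤s ())))

  nb : V → List V
  nb v = filterᵇ (A v) (allFin n)

  ∈-nb : ∀ {v x} → v ~ x → x ∈ nb v
  ∈-nb {v} {x} v~x = ∈-filter⁺ (T? ∘ A v) (∈-allFin x) (Equivalence.from T-≡ v~x)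

  nb-~ : ∀ {v x} → x ∈ nb v → v ~ x
  nb-~ {v} x∈ = Equivalence.to T-≡ (proj₂ (∈-filter⁻ (T? ∘ A v) {xs = allFin n} x∈))

  length-nb : ∀ v → length (nb v) ≤ 5
  length-nb v = ≤-trans (≤-reflexive (length-filterᵇ (A v) (allFin n))) (Δ≤5 v)

  -- The neighbours of `v` with the known ones first. Matching on `rest`, whose length `size`
  -- limits, leaves finitely many shapes.
  record Extension (v : V) (L : List V) : Set where
    field
      rest   : List V
      perm   : nb v ↭ L ++ rest
      size   : length (L ++ rest) ≤ 5
      unique : Unique (L ++ rest)
      adjacent : All (v ~_) (L ++ rest)

  extend : ∀ {v L} → Unique L → All (v ~_) L → Extension v L
  extend {v} uL v~L = let (R , p) = extract uL (All.map ∈-nb v~L) in record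
    { rest     = R
    ; perm     = p
    ; size     = subst (_≤ 5) (↭-length p) (length-nb v)
    ; unique   = Unique-resp-↭ p (Uniqueₚ.filter⁺ (T? ∘ A v) (Uniqueₚ.allFin⁺ n))
    ; adjacent = All-resp-↭ p (All.tabulate nb-~)
    }

  -- Edges inside a neighbourhood, codegrees, and the bound 8.

  edges : List V → ℕ
  edges []      = 0
  edges (x ∷ L) = Σ[ L ] (ι ∘ A x) + edges L

  edges-↭ : ∀ {L M} → L ↭ M → edges L ≡ edges M
  edges-↭ refl          = refl
  edges-↭ (prep x p)    = cong₂ _+_ (Σ-↭ (ι ∘ A x) p) (edges-↭ p)
  edges-↭ (trans p q)   = ≡-trans (edges-↭ p) (edges-↭ q)
  edges-↭ (swap {xs} {ys} x y p)
    rewrite Graph.sym G x y | Σ-↭ (ι ∘ A x) p | Σ-↭ (ι ∘ A y) p | edges-↭ p =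
    exchange (ι (A y x)) (Σ[ ys ] (ι ∘ A x)) (Σ[ ys ] (ι ∘ A y)) (edges ys)
    where
    exchange : ∀ e a b c → (e + a) + (b + c) ≡ (e + b) + (a + c)
    exchange = solve-∀

  handshake : ∀ L → Σ[ L ] (λ x → Σ[ L ] (ι ∘ A x)) ≡ 2 * edges L
  handshake []      = refl
  handshake (x ∷ L) rewrite irrefl G x
    | Σ-+ L (λ y → ι (A y x)) (λ y → Σ[ L ] (ι ∘ A y)) | handshake L
    | Σ-cong L (λ y → cong ι (Graph.sym G y x)) =
    twice (Σ[ L ] (ι ∘ A x)) (edges L)
    where
    twice : ∀ a e → a + (a + 2 * e) ≡ 2 * (a + e)
    twice = solve-∀

  t : V → ℕ
  t v = edges (nb v)

  -- For adjacent `u` and `v` this is also the degree of `u` in the graph induced on the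
  -- neighbourhood of `v`.
  codeg : V → V → ℕ
  codeg u v = Σ[ nb v ] (ι ∘ A u)

  codeg-sym : ∀ u v → codeg u v ≡ codeg v u
  codeg-sym u v = ≡-trans (Σ-filterᵇ (A v) (allFin n) _) (≡-trans
    (Σ-cong (allFin n) λ x → *-comm (ι (A v x)) (ι (A u x)))
    (≡-sym (Σ-filterᵇ (A u) (allFin n) _)))

  Σ-codeg : ∀ v → Σ[ nb v ] (λ u → codeg u v) ≡ 2 * t v
  Σ-codeg v = handshake (nb v)

  -- The sum has the bracketing and the trailing zeros to which `edges` of a four-element list
  -- reduces; the hypothesis excludes the complete graph.
  edges₄≤5 : ∀ a b c d e f → (a ∧ b ∧ c ∧ d ∧ e ∧ f ≡ false) →
    (ι a + (ι b + (ι c + 0))) + ((ι d + (ι e + 0)) + ((ι f + 0) + 0)) ≤ 5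
  edges₄≤5 = toWitness {a? = ∀ᵇ? λ a → ∀ᵇ? λ b → ∀ᵇ? λ c → ∀ᵇ? λ d → ∀ᵇ? λ e → ∀ᵇ? λ f →
    (_ ≟ᵇ _) →-dec (_ ≤? _)} tt

  edges₃≤3 : ∀ a b c → (ι a + (ι b + 0)) + ((ι c + 0) + 0) ≤ 3
  edges₃≤3 = toWitness {a? = ∀ᵇ? λ a → ∀ᵇ? λ b → ∀ᵇ? λ c → _ ≤? _} tt

  -- Four neighbours of `v` cannot be pairwise adjacent, as they would form a K₅ with `v`; so one of
  -- their six pairs is missing.
  edges≤5 : ∀ {v} L → length L ≤ 4 → All (v ~_) L → edges L ≤ 5
  edges≤5 [] _ _ = z≤n
  edges≤5 (x ∷ []) _ _ = z≤n
  edges≤5 (x ∷ y ∷ []) _ _ with A x y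
  ... | true  = s≤s z≤n
  ... | false = z≤n
  edges≤5 (x ∷ y ∷ z ∷ []) _ _ = ≤-trans (edges₃≤3 (A x y) (A x z) (A y z)) (m≤n+m 3 2)
  edges≤5 (x ∷ y ∷ z ∷ w ∷ []) _ (vx ∷ vy ∷ vz ∷ vw ∷ []) =
    edges₄≤5 (A x y) (A x z) (A x w) (A y z) (A y w) (A z w) (∧₆-false _ _ _ _ _ _
      λ xy xz xw yz yw zw → no-K₅ ((vx ∷ vy ∷ vz ∷ vw ∷ []) ∷ (xy ∷ xz ∷ xw ∷ [])
        ∷ (yz ∷ yw ∷ []) ∷ (zw ∷ []) ∷ [] ∷ []))
    where
    ∧₆-false : ∀ a b c d e f → (a ≡ true → b ≡ true → c ≡ true → d ≡ true → e ≡ true → f ≡ true → Empty) →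
      a ∧ b ∧ c ∧ d ∧ e ∧ f ≡ false
    ∧₆-false false _ _ _ _ _ _ = refl
    ∧₆-false true false _ _ _ _ _ = refl
    ∧₆-false true true false _ _ _ _ = refl
    ∧₆-false true true true false _ _ _ = refl
    ∧₆-false true true true true false _ _ = refl
    ∧₆-false true true true true true false _ = refl
    ∧₆-false true true true true true true h = absurd (h refl refl refl refl refl refl)
  edges≤5 (_ ∷ _ ∷ _ ∷ _ ∷ _ ∷ _) (s≤s (s≤s (s≤s (s≤s ())))) _

  -- Deleting `u` from the neighbourhood of `v` destroys `codeg u v` edges and leaves at most four
  -- vertices, which span at most five.
  t≤5+codeg : ∀ {u v} → v ~ u → t v ≤ 5 + codeg u v
  t≤5+codeg {u} {v} v~u = begin
    t v                                  ≡⟨ edges-↭ perm ⟩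
    Σ[ rest ] (ι ∘ A u) + edges rest     ≤⟨ +-monoʳ-≤ _ (edges≤5 rest (≤-pred size) (All.tail adjacent)) ⟩
    Σ[ rest ] (ι ∘ A u) + 5              ≡⟨ +-comm _ 5 ⟩
    5 + Σ[ rest ] (ι ∘ A u)              ≡⟨ cong (λ b → 5 + (ι b + Σ[ rest ] (ι ∘ A u))) (≡-sym (irrefl G u)) ⟩
    5 + Σ[ u ∷ rest ] (ι ∘ A u)          ≡⟨ cong (5 +_) (≡-sym (Σ-↭ (ι ∘ A u) perm)) ⟩
    5 + codeg u v                        ∎
    where
    open ≤-Reasoning
    open Extension (extend {v} {u ∷ []} ([] ∷ []) (v~u ∷ []))

  length-nb≡5 : ∀ {v} → 5 < t v → length (nb v) ≡ 5
  length-nb≡5 {v} 5<t with m≤n⇒m<n∨m≡n (length-nb v)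
  ... | inj₁ (s≤s short) = contradiction (edges≤5 (nb v) short (All.tabulate nb-~)) (<⇒≱ 5<t)
  ... | inj₂ eq          = eq

  -- More than five edges force five neighbours, whose codegrees with `v` sum to `2 * t v`; some
  -- codegree lies below `k` if the average does.
  low-codeg : ∀ k {v} → 5 < t v → 2 * t v < k * 5 → ∃ λ u → v ~ u × codeg u v < k
  low-codeg k {v} 5<t h =
    let (u , u∈ , c<k) = some-below k (nb v) (subst (_< k * length (nb v)) (≡-sym (Σ-codeg v))
          (subst (λ l → 2 * t v < k * l) (≡-sym (length-nb≡5 5<t)) h))
    in u , nb-~ u∈ , c<k

  t≤8 : ∀ v → t v ≤ 8
  t≤8 v with t v ≤? 8
  ... | yes p = p
  ... | no ¬p with m≤n⇒∃[o]m+o≡n (≰⇒> ¬p)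
  ...   | s , 9+s≡t =
    -- With `t v` = 9 + s the average codegree is (18 + 2s)/5 < 4 + s, so some neighbour has
    -- codegree at most 3 + s. Then `t v` is at most 8 + s, a contradiction.
    let (u , v~u , c<) = low-codeg (4 + s) {v} (≤-trans (m≤m+n 6 3) (≰⇒> ¬p)) few
    in contradiction (≤-trans (≤-reflexive 9+s≡t) (t≤5+codeg v~u)) (<⇒≱ (+-monoʳ-< 5 c<))
    where
    expand : ∀ s → suc (2 * (9 + s)) + (1 + 3 * s) ≡ (4 + s) * 5
    expand = solve-∀
    few : 2 * t v < (4 + s) * 5
    few = subst (λ m → 2 * m < (4 + s) * 5) 9+s≡t (≤-trans (m≤m+n _ _) (≤-reflexive (expand s)))

  -- Blocks: the surroundings of a vertex with t = 8.

  -- The six vertices induce K₆ minus the matching `wx`, `yz`: adjacent twins `v`, `b` joined to the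
  -- rim, the 4-cycle `w y x z`. Non-adjacency alone would allow equal vertices, hence the two
  -- disequalities.
  record Block (v b w x y z : V) : Set where
    field
      v~b : v ~ b
      v~w : v ~ w
      v~x : v ~ x
      v~y : v ~ y
      v~z : v ~ z
      b~w : b ~ w
      b~x : b ~ x
      b~y : b ~ y
      b~z : b ~ z
      w~y : w ~ y
      w~z : w ~ z
      x~y : x ~ y
      x~z : x ~ z
      w≁x : w ≁ x
      y≁z : y ≁ z
      w≢x : w ≢ x
      y≢z : y ≢ z

  open Block

  -- This and the next three maps are symmetries of a block; through them a fact about `w` reaches
  -- every rim vertex, and a fact about `v` reaches `b`.
  swap-wx : ∀ {v b w x y z} → Block v b w x y z → Block v b x w y z
  swap-wx B = record
    { v~b = v~b B ; v~w = v~x B ; v~x = v~w B ; v~y = v~y B ; v~z = v~z B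
    ; b~w = b~x B ; b~x = b~w B ; b~y = b~y B ; b~z = b~z B
    ; w~y = x~y B ; w~z = x~z B ; x~y = w~y B ; x~z = w~z B
    ; w≁x = ≁-sym (w≁x B) ; y≁z = y≁z B ; w≢x = w≢x B ∘ ≡-sym ; y≢z = y≢z B }

  swap-pairs : ∀ {v b w x y z} → Block v b w x y z → Block v b y z w x
  swap-pairs B = record
    { v~b = v~b B ; v~w = v~y B ; v~x = v~z B ; v~y = v~w B ; v~z = v~x B
    ; b~w = b~y B ; b~x = b~z B ; b~y = b~w B ; b~z = b~x B
    ; w~y = ~-sym (w~y B) ; w~z = ~-sym (x~y B) ; x~y = ~-sym (w~z B) ; x~z = ~-sym (x~z B)
    ; w≁x = y≁z B ; y≁z = w≁x B ; w≢x = y≢z B ; y≢z = w≢x B }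

  swap-yz : ∀ {v b w x y z} → Block v b w x y z → Block v b w x z y
  swap-yz = swap-pairs ∘ swap-wx ∘ swap-pairs

  swap-vb : ∀ {v b w x y z} → Block v b w x y z → Block b v w x y z
  swap-vb B = record
    { v~b = ~-sym (v~b B) ; v~w = b~w B ; v~x = b~x B ; v~y = b~y B ; v~z = b~z B
    ; b~w = v~w B ; b~x = v~x B ; b~y = v~y B ; b~z = v~z B
    ; w~y = w~y B ; w~z = w~z B ; x~y = x~y B ; x~z = x~z B
    ; w≁x = w≁x B ; y≁z = y≁z B ; w≢x = w≢x B ; y≢z = y≢z B }

  full : ∀ {v a b c d e} → Unique (a ∷ b ∷ c ∷ d ∷ e ∷ []) → All (v ~_) (a ∷ b ∷ c ∷ d ∷ e ∷ []) →
    nb v ↭ a ∷ b ∷ c ∷ d ∷ e ∷ []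
  full u p with extend u p
  ... | record { rest = [] ; perm = perm } = perm
  ... | record { rest = _ ∷ _ ; size = s≤s (s≤s (s≤s (s≤s (s≤s ())))) }

  nb-v : ∀ {v b w x y z} → Block v b w x y z → nb v ↭ b ∷ w ∷ x ∷ y ∷ z ∷ []
  nb-v B = full
    ((~⇒≢ (b~w B) ∷ ~⇒≢ (b~x B) ∷ ~⇒≢ (b~y B) ∷ ~⇒≢ (b~z B) ∷ [])
      ∷ (w≢x B ∷ ~⇒≢ (w~y B) ∷ ~⇒≢ (w~z B) ∷ [])
      ∷ (~⇒≢ (x~y B) ∷ ~⇒≢ (x~z B) ∷ []) ∷ (y≢z B ∷ []) ∷ [] ∷ [])
    (v~b B ∷ v~w B ∷ v~x B ∷ v~y B ∷ v~z B ∷ [])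

  t-v : ∀ {v b w x y z} → Block v b w x y z → t v ≡ 8
  t-v {v} B rewrite edges-↭ (nb-v B) | b~w B | b~x B | b~y B | b~z B
    | w~y B | w~z B | x~y B | x~z B | w≁x B | y≁z B = refl

  Σ-ι≤length : ∀ (p : V → Bool) L → Σ[ L ] (ι ∘ p) ≤ length L
  Σ-ι≤length p []      = z≤n
  Σ-ι≤length p (x ∷ L) with p x
  ... | true  = s≤s (Σ-ι≤length p L)
  ... | false = m≤n⇒m≤1+n (Σ-ι≤length p L)

  Σ-ι-full : ∀ (p : V → Bool) L → length L ≤ Σ[ L ] (ι ∘ p) → All (λ x → p x ≡ true) L
  Σ-ι-full p []      h = []
  Σ-ι-full p (x ∷ L) h with p x in eq
  ... | true  = eq ∷ Σ-ι-full p L (≤-pred h)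
  ... | false = contradiction (Σ-ι≤length p L) (<⇒≱ h)

  -- The bits stand for `pq`, `pr`, `ps`, `qr`, `qs`, `rs`. Four edges on four vertices without a
  -- triangle form a 4-cycle, and the three alternatives name the perfect matching that is missing.
  C₄-unique : ∀ a b c d e f →
    (ι a + (ι b + (ι c + 0))) + ((ι d + (ι e + 0)) + ((ι f + 0) + 0)) ≡ 4 →
    a ∧ b ∧ d ≡ false → a ∧ c ∧ e ≡ false → b ∧ c ∧ f ≡ false → d ∧ e ∧ f ≡ false →
    (a ≡ false × f ≡ false × b ≡ true × c ≡ true × d ≡ true × e ≡ true)
    ⊎ (b ≡ false × e ≡ false × a ≡ true × c ≡ true × d ≡ true × f ≡ true)
    ⊎ (c ≡ false × d ≡ false × a ≡ true × b ≡ true × e ≡ true × f ≡ true)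
  C₄-unique = toWitness {a? = ∀ᵇ? λ a → ∀ᵇ? λ b → ∀ᵇ? λ c → ∀ᵇ? λ d → ∀ᵇ? λ e → ∀ᵇ? λ f →
    (_ ≟ℕ _) →-dec (_ ≟ᵇ _) →-dec (_ ≟ᵇ _) →-dec (_ ≟ᵇ _) →-dec (_ ≟ᵇ _) →-dec
      (six? a f b c d e ⊎-dec (six? b e a c d f ⊎-dec six? c d a b e f))} tt
    where
    six? : ∀ p q r s t u →
      Dec (p ≡ false × q ≡ false × r ≡ true × s ≡ true × t ≡ true × u ≡ true)
    six? p q r s t u = (p ≟ᵇ false) ×-dec (q ≟ᵇ false) ×-dec (r ≟ᵇ true) ×-dec (s ≟ᵇ true)
      ×-dec (t ≟ᵇ true) ×-dec (u ≟ᵇ true)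

  ∧₃-false : ∀ a b c → (a ≡ true → b ≡ true → c ≡ true → Empty) → a ∧ b ∧ c ≡ false
  ∧₃-false false _ _ _ = refl
  ∧₃-false true false _ _ = refl
  ∧₃-false true true false _ = refl
  ∧₃-false true true true h = absurd (h refl refl refl)

  -- A triangle in `R` would make a K₅ with `v` and `b`, so the four edges of `R` form a 4-cycle.
  block-of-twin : ∀ {v b} R → length R ≡ 4 → Unique R → All (v ~_) (b ∷ R) → All (b ~_) R →
    edges R ≡ 4 → ∃₂ λ w x → ∃₂ λ y z → Block v b w x y z
  block-of-twin {v} {b} (p ∷ q ∷ r ∷ s ∷ []) refl
    ((p≢q ∷ p≢r ∷ p≢s ∷ []) ∷ (q≢r ∷ q≢s ∷ []) ∷ (r≢s ∷ []) ∷ _)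
    (vb ∷ vp ∷ vq ∷ vr ∷ vs ∷ []) (bp ∷ bq ∷ br ∷ bs ∷ []) four
    = cases (C₄-unique (A p q) (A p r) (A p s) (A q r) (A q s) (A r s) four
      (triangle bp bq br vp vq vr) (triangle bp bq bs vp vq vs) (triangle bp br bs vp vr vs) (triangle bq br bs vq vr vs))
    where
    triangle : ∀ {x y z} → b ~ x → b ~ y → b ~ z → v ~ x → v ~ y → v ~ z → A x y ∧ A x z ∧ A y z ≡ false
    triangle bx by bz vx vy vz = ∧₃-false _ _ _ λ xy xz yz →
      no-K₅ ((vb ∷ vx ∷ vy ∷ vz ∷ []) ∷ (bx ∷ by ∷ bz ∷ []) ∷ (xy ∷ xz ∷ []) ∷ (yz ∷ []) ∷ [] ∷ [])
    cases : _ → ∃₂ λ w x → ∃₂ λ y z → Block v b w x y z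
    cases (inj₁ (pq , rs , pr , ps , qr , qs)) = p , q , r , s , record
      { v~b = vb ; v~w = vp ; v~x = vq ; v~y = vr ; v~z = vs ; b~w = bp ; b~x = bq ; b~y = br ; b~z = bs
      ; w~y = pr ; w~z = ps ; x~y = qr ; x~z = qs ; w≁x = pq ; y≁z = rs ; w≢x = p≢q ; y≢z = r≢s }
    cases (inj₂ (inj₁ (pr , qs , pq , ps , qr , rs))) = p , r , q , s , record
      { v~b = vb ; v~w = vp ; v~x = vr ; v~y = vq ; v~z = vs ; b~w = bp ; b~x = br ; b~y = bq ; b~z = bs
      ; w~y = pq ; w~z = ps ; x~y = ~-sym qr ; x~z = rs ; w≁x = pr ; y≁z = qs ; w≢x = p≢r ; y≢z = q≢s }
    cases (inj₂ (inj₂ (ps , qr , pq , pr , qs , rs))) = p , s , q , r , record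
      { v~b = vb ; v~w = vp ; v~x = vs ; v~y = vq ; v~z = vr ; b~w = bp ; b~x = bs ; b~y = bq ; b~z = br
      ; w~y = pq ; w~z = pr ; x~y = ~-sym qs ; x~z = ~-sym rs ; w≁x = ps ; y≁z = qr ; w≢x = p≢s ; y≢z = q≢r }

  block : ∀ {v} → t v ≡ 8 → ∃ λ b → ∃₂ λ w x → ∃₂ λ y z → Block v b w x y z
  block {v} t≡8 = b , block-of-twin rest length≡4 (AllPairs.tail unique) adjacent
      (Σ-ι-full (A b) rest (subst (_≤ Σ[ rest ] (ι ∘ A b)) (≡-sym length≡4) 4≤))
      (+-cancelˡ-≡ 4 _ _ (≡-trans (cong (_+ edges rest) Σ≡4) (≡-trans (≡-sym (edges-↭ perm)) t≡8)))
    where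
    -- The codegrees sum to 16 > 3 * 5, so some neighbour `b` is adjacent to all four others. It
    -- accounts for four of the eight edges and leaves four in `rest`.
    twin = some-above 3 (nb v) {λ u → codeg u v} (≤-trans (s≤s (*-monoʳ-≤ 3 (length-nb v)))
      (≤-reflexive (≡-sym (≡-trans (Σ-codeg v) (cong (2 *_) t≡8)))))
    b = proj₁ twin
    3<c = proj₂ (proj₂ twin)
    open Extension (extend {v} {b ∷ []} ([] ∷ []) (nb-~ (proj₁ (proj₂ twin)) ∷ []))
    codeg-rest : codeg b v ≡ Σ[ rest ] (ι ∘ A b)
    codeg-rest = ≡-trans (Σ-↭ (ι ∘ A b) perm) (cong (λ e → ι e + Σ[ rest ] (ι ∘ A b)) (irrefl G b))
    4≤ = subst (3 <_) codeg-rest 3<c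
    length≡4 : length rest ≡ 4
    length≡4 = ≤-antisym (≤-pred size) (≤-trans 4≤ (Σ-ι≤length (A b) rest))
    Σ≡4 : 4 ≡ Σ[ rest ] (ι ∘ A b)
    Σ≡4 = ≤-antisym 4≤ (subst (Σ[ rest ] (ι ∘ A b) ≤_) length≡4 (Σ-ι≤length (A b) rest))

  ∈-block : ∀ {v b w x y z u} → Block v b w x y z → v ~ u → u ∈ b ∷ w ∷ x ∷ y ∷ z ∷ []
  ∈-block B v~u = ∈-resp-↭ (nb-v B) (∈-nb v~u)

  ≁-intro : ∀ {x y} → ¬ (x ~ y) → x ≁ y
  ≁-intro = ¬-not

  -- Neighbourhoods of rim vertices.

  -- Four neighbours of `w` lie in the block, so at most one, `r`, lies outside. The twins miss `r`
  -- because the block uses up their degree.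
  data RimNbhd (v b w y z : V) : Set where
    inner : nb w ↭ v ∷ b ∷ y ∷ z ∷ [] → RimNbhd v b w y z
    outer : ∀ r → nb w ↭ v ∷ b ∷ y ∷ z ∷ r ∷ [] → w ~ r → v ≁ r → b ≁ r → y ≢ r → z ≢ r →
      RimNbhd v b w y z

  rimNbhd : ∀ {v b w x y z} → Block v b w x y z → RimNbhd v b w y z
  rimNbhd {v} {b} {w} {x} {y} {z} B
    with extend {w} {v ∷ b ∷ y ∷ z ∷ []}
      ((~⇒≢ (v~b B) ∷ ~⇒≢ (v~y B) ∷ ~⇒≢ (v~z B) ∷ [])
        ∷ (~⇒≢ (b~y B) ∷ ~⇒≢ (b~z B) ∷ []) ∷ (y≢z B ∷ []) ∷ [] ∷ [])
      (~-sym (v~w B) ∷ ~-sym (b~w B) ∷ w~y B ∷ w~z B ∷ [])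
  ... | record { rest = [] ; perm = perm } = inner perm
  ... | record { rest = _ ∷ _ ∷ _ ; size = s≤s (s≤s (s≤s (s≤s (s≤s ())))) }
  ... | record { rest = r ∷ [] ; perm = perm
               ; unique = (_ ∷ _ ∷ _ ∷ v≢r ∷ []) ∷ (_ ∷ _ ∷ b≢r ∷ []) ∷ (_ ∷ y≢r ∷ []) ∷ (z≢r ∷ []) ∷ _
               ; adjacent = _ ∷ _ ∷ _ ∷ _ ∷ w~r ∷ [] } =
    outer r perm w~r (≁-intro v≁r) (≁-intro b≁r) y≢r z≢r
    where
    v≁r : ¬ (v ~ r)
    v≁r v~r with ∈-block B v~r
    ... | here r≡b                          = b≢r (≡-sym r≡b)
    ... | there (here r≡w)                  = ~⇒≢ w~r (≡-sym r≡w)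
    ... | there (there (here refl))         = ~×≁ w~r (w≁x B)
    ... | there (there (there (here r≡y)))  = y≢r (≡-sym r≡y)
    ... | there (there (there (there (here r≡z)))) = z≢r (≡-sym r≡z)
    b≁r : ¬ (b ~ r)
    b≁r b~r with ∈-block (swap-vb B) b~r
    ... | here r≡v                          = v≢r (≡-sym r≡v)
    ... | there (here r≡w)                  = ~⇒≢ w~r (≡-sym r≡w)
    ... | there (there (here refl))         = ~×≁ w~r (w≁x B)
    ... | there (there (there (here r≡y)))  = y≢r (≡-sym r≡y)
    ... | there (there (there (there (here r≡z)))) = z≢r (≡-sym r≡z)

  t-inner : ∀ {v b w x y z} → Block v b w x y z → nb w ↭ v ∷ b ∷ y ∷ z ∷ [] → t w ≡ 5
  t-inner B p rewrite edges-↭ p | v~b B | v~y B | v~z B | b~y B | b~z B | y≁z B = refl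

  t-outer : ∀ {v b w x y z r} → Block v b w x y z → nb w ↭ v ∷ b ∷ y ∷ z ∷ r ∷ [] → v ≁ r → b ≁ r →
    t w ≡ 5 + (ι (A y r) + ι (A z r))
  t-outer {y = y} {z} {r} B p vr br
    rewrite edges-↭ p | v~b B | v~y B | v~z B | b~y B | b~z B | y≁z B | vr | br =
    cong (5 +_) (cong₂ _+_ (+-identityʳ (ι (A y r))) (≡-trans (+-identityʳ (ι (A z r) + 0)) (+-identityʳ (ι (A z r)))))

  t-rim≤7 : ∀ {v b w x y z} → Block v b w x y z → t w ≤ 7
  t-rim≤7 {y = y} {z} B with rimNbhd B
  ... | inner p rewrite t-inner B p = m≤m+n 5 2
  ... | outer r p _ vr br _ _ rewrite t-outer B p vr br with A y r | A z r
  ...   | true  | true  = ≤-refl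
  ...   | true  | false = m≤m+n 6 1
  ...   | false | true  = m≤m+n 6 1
  ...   | false | false = m≤m+n 5 2

  t-rim≡7 : ∀ {v b w x y z} → Block v b w x y z → t w ≡ 7 →
    ∃ λ r → nb w ↭ v ∷ b ∷ y ∷ z ∷ r ∷ [] × w ~ r × v ≁ r × b ≁ r × y ~ r × z ~ r
  t-rim≡7 {y = y} {z} B t≡7 with rimNbhd B
  ... | inner p = contradiction (≡-trans (≡-sym (t-inner B p)) t≡7) λ ()
  ... | outer r p wr vr br _ _ with both (A y r) (A z r) (+-cancelˡ-≡ 5 _ 2 (≡-trans (≡-sym (t-outer B p vr br)) t≡7))
    where
    both : ∀ a b → ι a + ι b ≡ 2 → a ≡ true × b ≡ true
    both true true _ = refl , refl
    both true false ()
    both false true ()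
    both false false ()
  ... | yr , zr = r , p , wr , vr , br , yr , zr

  -- Of the neighbours of `w`, only `y` and `z` can be adjacent to `r`; codegree at most 2 gives
  -- `t r` at most 7.
  t-outer≢8 : ∀ {v b w x y z r} → Block v b w x y z → nb w ↭ v ∷ b ∷ y ∷ z ∷ r ∷ [] →
    w ~ r → v ≁ r → b ≁ r → t r ≢ 8
  t-outer≢8 {v} {b} {w} {y = y} {z} {r} B p wr vr br t≡8 =
    contradiction (≤-trans (≤-reflexive (≡-sym t≡8)) (t≤5+codeg (~-sym wr))) (<⇒≱ (s≤s (+-monoʳ-≤ 5 codeg≤2)))
    where
    codeg≤2 : codeg w r ≤ 2
    codeg≤2 rewrite codeg-sym w r | Σ-↭ (ι ∘ A r) p | ≁-sym vr | ≁-sym br | irrefl G r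
      with A r y | A r z
    ... | true  | true  = ≤-refl
    ... | true  | false = s≤s z≤n
    ... | false | true  = s≤s z≤n
    ... | false | false = z≤n

  place-at-rim : ∀ {v b w x y z u} → Block v b w x y z → t u ≢ 8 → u ∈ b ∷ w ∷ x ∷ y ∷ z ∷ [] →
    ∃₂ λ b x → ∃₂ λ y z → Block v b u x y z
  place-at-rim B t≢8 (here refl)                         = contradiction (t-v (swap-vb B)) t≢8
  place-at-rim B t≢8 (there (here refl))                 = _ , _ , _ , _ , B
  place-at-rim B t≢8 (there (there (here refl)))         = _ , _ , _ , _ , swap-wx B
  place-at-rim B t≢8 (there (there (there (here refl)))) = _ , _ , _ , _ , swap-pairs B
  place-at-rim B t≢8 (there (there (there (there (here refl))))) = _ , _ , _ , _ , swap-wx (swap-pairs B)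

  block-at-rim : ∀ {v w} → t v ≡ 8 → v ~ w → t w ≢ 8 → ∃₂ λ b x → ∃₂ λ y z → Block v b w x y z
  block-at-rim t≡8 v~w t≢8 =
    let (_ , _ , _ , _ , _ , B) = block t≡8 in place-at-rim B t≢8 (∈-block B v~w)

  rim-full : ∀ {v b w x y z r} → Block v b w x y z → w ~ r → v ≁ r → b ≁ r → y ≢ r → z ≢ r →
    nb w ↭ v ∷ b ∷ y ∷ z ∷ r ∷ []
  rim-full B wr vr br y≢r z≢r = full
    ((~⇒≢ (v~b B) ∷ ~⇒≢ (v~y B) ∷ ~⇒≢ (v~z B) ∷ ~×≁⇒≢ (~-sym (v~b B)) br ∷ [])
      ∷ (~⇒≢ (b~y B) ∷ ~⇒≢ (b~z B) ∷ ~×≁⇒≢ (v~b B) vr ∷ []) ∷ (y≢z B ∷ y≢r ∷ []) ∷ (z≢r ∷ []) ∷ [] ∷ [])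
    (~-sym (v~w B) ∷ ~-sym (b~w B) ∷ w~y B ∷ w~z B ∷ wr ∷ [])

  -- The edge `yr` comes on top of the five edges among `v`, `b`, `y`, `z`.
  t-rim≥6 : ∀ {v b w x y z r} → Block v b w x y z → w ~ r → v ≁ r → b ≁ r → y ~ r → z ≢ r → 6 ≤ t w
  t-rim≥6 {y = y} {r = r} B wr vr br yr z≢r
    rewrite t-outer B (rim-full B wr vr br (~⇒≢ yr) z≢r) vr br | yr = m≤m+n 6 _

  -- An outside vertex adjacent to three rim vertices.

  module _ {v b w x y z r} (B : Block v b w x y z) (wr : w ~ r) (vr : v ≁ r) (br : b ≁ r)
    (yr : y ~ r) (zr : z ~ r) where

    private
      x≢r : x ≢ r
      x≢r = ~×≁⇒≢ wr (w≁x B) ∘ ≡-sym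

      nb-w = rim-full B wr vr br (~⇒≢ yr) (~⇒≢ zr)
      nb-y = rim-full (swap-pairs B) yr vr br (~⇒≢ wr) x≢r
      nb-z = rim-full (swap-pairs (swap-yz B)) zr vr br (~⇒≢ wr) x≢r

      -- The five neighbours of `w` are `v`, `b`, `y`, `z`, `r`, and `r` misses `v` and `b`.
      w-misses : ∀ {p} → r ~ p → y ≢ p → z ≢ p → w ≁ p
      w-misses rp y≢p z≢p = ≁-intro λ wp → check (∈-resp-↭ nb-w (∈-nb wp))
        where
        check : _ → Empty
        check (here refl)                         = ~×≁ (~-sym rp) vr
        check (there (here refl))                 = ~×≁ (~-sym rp) br
        check (there (there (here p≡y)))          = y≢p (≡-sym p≡y)
        check (there (there (there (here p≡z))))  = z≢p (≡-sym p≡z)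
        check (there (there (there (there (here p≡r))))) = ~⇒≢ rp (≡-sym p≡r)

      outside-rim : ∀ {p} → r ~ p → w ≢ p → x ≢ p → p ∉ v ∷ b ∷ w ∷ x ∷ r ∷ []
      outside-rim rp w≢p x≢p (here refl)                         = ~×≁ (~-sym rp) vr
      outside-rim rp w≢p x≢p (there (here refl))                 = ~×≁ (~-sym rp) br
      outside-rim rp w≢p x≢p (there (there (here p≡w)))          = w≢p (≡-sym p≡w)
      outside-rim rp w≢p x≢p (there (there (there (here p≡x))))  = x≢p (≡-sym p≡x)
      outside-rim rp w≢p x≢p (there (there (there (there (here p≡r))))) = ~⇒≢ rp (≡-sym p≡r)

      y-misses : ∀ {p} → r ~ p → w ≢ p → x ≢ p → y ≁ p
      y-misses rp w≢p x≢p = ≁-intro λ yp → outside-rim rp w≢p x≢p (∈-resp-↭ nb-y (∈-nb yp))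

      z-misses : ∀ {p} → r ~ p → w ≢ p → x ≢ p → z ≁ p
      z-misses rp w≢p x≢p = ≁-intro λ zp → outside-rim rp w≢p x≢p (∈-resp-↭ nb-z (∈-nb zp))

      -- Once `r` is adjacent to `x`, the neighbourhood of `x` is full in the same way as that of
      -- `w`.
      x-misses : ∀ {p} → r ~ x → r ~ p → y ≢ p → z ≢ p → x ≁ p
      x-misses rx rp y≢p z≢p = ≁-intro λ xp →
        check (∈-resp-↭ (rim-full (swap-wx B) (~-sym rx) vr br (~⇒≢ yr) (~⇒≢ zr)) (∈-nb xp))
        where
        check : _ → Empty
        check (here refl)                         = ~×≁ (~-sym rp) vr
        check (there (here refl))                 = ~×≁ (~-sym rp) br
        check (there (there (here p≡y)))          = y≢p (≡-sym p≡y)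
        check (there (there (there (here p≡z))))  = z≢p (≡-sym p≡z)
        check (there (there (there (there (here p≡r))))) = ~⇒≢ rp (≡-sym p≡r)

      two : ∀ a b → (ι a + 0) + ((ι b + 0) + 0) ≤ 2
      two true  true  = ≤-refl
      two true  false = s≤s z≤n
      two false true  = s≤s z≤n
      two false false = z≤n

      tail≤4 : ∀ R → nb r ↭ w ∷ y ∷ z ∷ R → length R ≤ 2 → Unique (w ∷ y ∷ z ∷ R) → All (r ~_) R → t r ≤ 4
      tail≤4 (_ ∷ _ ∷ _ ∷ _) _ (s≤s (s≤s ())) _ _
      tail≤4 [] perm _ _ _ rewrite edges-↭ perm | w~y B | w~z B | y≁z B = m≤m+n 2 2
      tail≤4 (p ∷ []) perm _ ((_ ∷ _ ∷ w≢p ∷ []) ∷ (_ ∷ y≢p ∷ []) ∷ (z≢p ∷ []) ∷ _) (rp ∷ [])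
        rewrite edges-↭ perm | w~y B | w~z B | y≁z B | w-misses rp y≢p z≢p = +-monoʳ-≤ 2 (two (A y p) (A z p))
      tail≤4 (p ∷ q ∷ []) perm _
        ((_ ∷ _ ∷ w≢p ∷ w≢q ∷ []) ∷ (_ ∷ y≢p ∷ y≢q ∷ []) ∷ (z≢p ∷ z≢q ∷ []) ∷ (p≢q ∷ []) ∷ _) (rp ∷ rq ∷ [])
        rewrite edges-↭ perm | w~y B | w~z B | y≁z B | w-misses rp y≢p z≢p | w-misses rq y≢q z≢q
        -- Besides `wy` and `wz`, further edges at `y` or `z` can only lead to `x`. If `x` is one of
        -- the two remaining neighbours of `r`, it misses the other and adds at most two edges;
        -- otherwise only `pq` can be added.
        with x ≟ p | x ≟ q
      ... | yes refl | yes refl = contradiction refl p≢q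
      ... | yes refl | no x≢q
        rewrite y-misses rq w≢q x≢q | z-misses rq w≢q x≢q | x-misses rp rq y≢q z≢q
        = +-monoʳ-≤ 2 (two (A y x) (A z x))
      ... | no x≢p | yes refl
        rewrite y-misses rp w≢p x≢p | z-misses rp w≢p x≢p | ≁-sym (x-misses rq rp y≢p z≢p)
        = +-monoʳ-≤ 2 (two (A y x) (A z x))
      ... | no x≢p | no x≢q
        rewrite y-misses rp w≢p x≢p | z-misses rp w≢p x≢p | y-misses rq w≢q x≢q | z-misses rq w≢q x≢q
        with A p q
      ...   | true  = m≤m+n 3 1
      ...   | false = m≤m+n 2 2

    t-apex≤4 : t r ≤ 4
    t-apex≤4 = tail≤4 rest perm (≤-pred (≤-pred (≤-pred size))) unique (All.tail (All.tail (All.tail adjacent)))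
      where
      open Extension (extend {r} {w ∷ y ∷ z ∷ []}
        ((~⇒≢ (w~y B) ∷ ~⇒≢ (w~z B) ∷ []) ∷ (y≢z B ∷ []) ∷ [] ∷ [])
        (~-sym wr ∷ ~-sym yr ∷ ~-sym zr ∷ []))

  -- The twins have t = 8, and `y`, `z` have t at least 6 because `r` is adjacent to them and to
  -- `w`. So `u` can only be the outside neighbour `r`, which is adjacent to `w`, `y` and `z`.
  rim-low : ∀ {v b w x y z u} → Block v b w x y z → t w ≡ 7 → w ~ u → t u ≤ 5 → t u ≤ 4
  rim-low {v} {b} {w} {x} {y} {z} {u} B t≡7 wu tu≤5 with t-rim≡7 B t≡7
  ... | r , p , wr , vr , br , yr , zr with ∈-resp-↭ p (∈-nb wu)
  ...   | here refl = contradiction (subst (_≤ 5) (t-v B) tu≤5) (<⇒≱ (m≤m+n 6 2))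
  ...   | there (here refl) = contradiction (subst (_≤ 5) (t-v (swap-vb B)) tu≤5) (<⇒≱ (m≤m+n 6 2))
  ...   | there (there (here refl)) = contradiction tu≤5
    (<⇒≱ (t-rim≥6 (swap-pairs B) yr vr br wr (~×≁⇒≢ wr (w≁x B) ∘ ≡-sym)))
  ...   | there (there (there (here refl))) = contradiction tu≤5
    (<⇒≱ (t-rim≥6 (swap-pairs (swap-yz B)) zr vr br wr (~×≁⇒≢ wr (w≁x B) ∘ ≡-sym)))
  ...   | there (there (there (there (here refl)))) = t-apex≤4 B wr vr br yr zr

  -- A vertex with t = 7 has a neighbour with t at most 5.

  degree-bound : ∀ {L} v → Unique L → Σ[ L ] (ι ∘ A v) ≤ 5
  degree-bound {L} v uL with extract uL (All.tabulate {xs = L} (λ {x} _ → ∈-allFin x))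
  ... | R , p = ≤-trans (m≤m+n _ (Σ[ R ] (ι ∘ A v)))
    (≤-trans (≤-reflexive (≡-trans (≡-sym (Σ-++ L R (ι ∘ A v))) (≡-sym (Σ-↭ (ι ∘ A v) p)))) (Δ≤5 v))

  edges≤1 : ∀ R → length R ≤ 2 → edges R ≤ 1
  edges≤1 []          _ = z≤n
  edges≤1 (p ∷ [])    _ = z≤n
  edges≤1 (p ∷ q ∷ []) _ with A p q
  ... | true  = ≤-refl
  ... | false = z≤n
  edges≤1 (_ ∷ _ ∷ _ ∷ _) (s≤s (s≤s ()))

  -- N(v) has 7 edges, so d and e already have many neighbours in N[v], hence few in N(a) ∖ N[v].
  low-at : ∀ {v a d e f g} → nb v ↭ a ∷ d ∷ e ∷ f ∷ g ∷ [] → Unique (a ∷ d ∷ e ∷ f ∷ g ∷ []) →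
    All (v ~_) (a ∷ d ∷ e ∷ f ∷ g ∷ []) → a ~ d → a ~ e → a ≁ f → a ≁ g → t v ≡ 7 → t a ≤ 5
  low-at {v} {a} {d} {e} {f} {g} perm
    ((a≢d ∷ a≢e ∷ a≢f ∷ a≢g ∷ []) ∷ (d≢e ∷ d≢f ∷ d≢g ∷ []) ∷ (e≢f ∷ e≢g ∷ []) ∷ (f≢g ∷ []) ∷ _)
    (va ∷ vd ∷ ve ∷ vf ∷ vg ∷ []) ad ae af ag t≡7
    = bound (extend {a} {v ∷ d ∷ e ∷ []} ((~⇒≢ vd ∷ ~⇒≢ ve ∷ []) ∷ (d≢e ∷ []) ∷ [] ∷ [])
        (~-sym va ∷ ad ∷ ae ∷ []))
    where
    inside : 2 + ((ι (A d e) + (ι (A d f) + ι (A d g))) + ((ι (A e f) + ι (A e g)) + ι (A f g))) ≡ 7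
    inside = ≡-trans (flatten (ι (A d e)) (ι (A d f)) (ι (A d g)) (ι (A e f)) (ι (A e g)) (ι (A f g)))
      (≡-trans (≡-sym count) t≡7)
      where
      flatten : ∀ de df dg ef eg fg → 2 + ((de + (df + dg)) + ((ef + eg) + fg))
        ≡ 2 + ((de + (df + (dg + 0))) + ((ef + (eg + 0)) + ((fg + 0) + 0)))
      flatten = solve-∀
      count : t v ≡ 2 + ((ι (A d e) + (ι (A d f) + (ι (A d g) + 0)))
        + ((ι (A e f) + (ι (A e g) + 0)) + ((ι (A f g) + 0) + 0)))
      count rewrite edges-↭ perm | ad | ae | af | ag = refl

    ι≤1 : ∀ b → ι b ≤ 1
    ι≤1 true  = ≤-refl
    ι≤1 false = z≤n

    -- Here `xd` and `xe` count edges from `d` and `e` to `R`. The two degree bounds and `fg` total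
    -- at most 11; the same total is 2, plus the seven edges around `v`, plus the quantity to be
    -- bounded.
    weigh : ∀ de d₂ e₂ fg xd xe → 2 + ((de + d₂) + (e₂ + fg)) ≡ 7 → fg ≤ 1 →
      2 + (de + (d₂ + xd)) ≤ 5 → 2 + (de + (e₂ + xe)) ≤ 5 → de + (xd + xe) ≤ 2
    weigh de d₂ e₂ fg xd xe seven fg≤1 dd dg = +-cancelˡ-≤ 9 _ _ (begin
      9 + (de + (xd + xe))                                      ≡⟨ cong (λ m → 2 + m + (de + (xd + xe))) (≡-sym seven) ⟩
      2 + (2 + ((de + d₂) + (e₂ + fg))) + (de + (xd + xe))      ≡⟨ regroup de d₂ e₂ fg xd xe ⟩
      (2 + (de + (d₂ + xd))) + (2 + (de + (e₂ + xe))) + fg      ≤⟨ +-mono-≤ (+-mono-≤ dd dg) fg≤1 ⟩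
      11                                                        ∎)
      where
      open ≤-Reasoning
      regroup : ∀ de d₂ e₂ fg xd xe → 2 + (2 + ((de + d₂) + (e₂ + fg))) + (de + (xd + xe))
        ≡ (2 + (de + (d₂ + xd))) + (2 + (de + (e₂ + xe))) + fg
      regroup = solve-∀

    bound : Extension a (v ∷ d ∷ e ∷ []) → t a ≤ 5
    bound record { rest = R ; perm = perm′ ; size = size
                 ; unique = (_ ∷ _ ∷ v∉R) ∷ (_ ∷ d∉R) ∷ e∉R ∷ uR ; adjacent = _ ∷ _ ∷ _ ∷ a~R } = begin
      t a
        ≡⟨ edges-↭ perm′ ⟩
      (ι (A v d) + (ι (A v e) + Σ[ R ] (ι ∘ A v))) + ((ι (A d e) + xd) + (xe + edges R))
        ≡⟨ cong (_+ ((ι (A d e) + xd) + (xe + edges R)))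
             (cong₂ _+_ (cong ι vd) (cong₂ _+_ (cong ι ve) (Σ-zero (All.map (cong ι) v≁R)))) ⟩
      2 + ((ι (A d e) + xd) + (xe + edges R))
        ≡⟨ cong (2 +_) (reassoc (ι (A d e)) xd xe (edges R)) ⟩
      2 + ((ι (A d e) + (xd + xe)) + edges R)
        -- Two edges from `v` to `d` and `e`, at most two among `de` and the edges to `R`, at most
        -- one inside `R`.
        ≤⟨ +-monoʳ-≤ 2 (+-mono-≤
             (weigh (ι (A d e)) (ι (A d f) + ι (A d g)) (ι (A e f) + ι (A e g)) (ι (A f g)) xd xe
                inside (ι≤1 (A f g)) deg-d deg-e)
             (edges≤1 R (≤-pred (≤-pred (≤-pred size))))) ⟩
      5 ∎
      where
      open ≤-Reasoning
      xd = Σ[ R ] (ι ∘ A d)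
      xe = Σ[ R ] (ι ∘ A e)
      reassoc : ∀ a b c d → (a + b) + (c + d) ≡ (a + (b + c)) + d
      reassoc = solve-∀
      misses : ∀ {r} → d ≢ r × e ≢ r × a ~ r → v ≁ r
      misses (d≢r , e≢r , ar) = ≁-intro λ vr → check (∈-resp-↭ perm (∈-nb vr))
        where
        check : _ → Empty
        check (here r≡a)                          = ~⇒≢ ar (≡-sym r≡a)
        check (there (here r≡d))                  = d≢r (≡-sym r≡d)
        check (there (there (here r≡e)))          = e≢r (≡-sym r≡e)
        check (there (there (there (here refl)))) = ~×≁ ar af
        check (there (there (there (there (here refl))))) = ~×≁ ar ag
      v≁R : All (v ≁_) R
      v≁R = All.zipWith (λ (x , y) → misses (x , y)) (d∉R , All.zip (e∉R , a~R))
      a∉R = All.map ~⇒≢ a~R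
      f∉R = All.map (λ ar → ~×≁⇒≢ ar af ∘ ≡-sym) a~R
      g∉R = All.map (λ ar → ~×≁⇒≢ ar ag ∘ ≡-sym) a~R
      deg-d : 2 + (ι (A d e) + ((ι (A d f) + ι (A d g)) + xd)) ≤ 5
      deg-d = subst (_≤ 5) (≡-trans (cong₂ (λ b c → ι b + (ι c + (ι (A d e) + (ι (A d f) + (ι (A d g) + xd)))))
            (~-sym vd) (~-sym ad))
          (cong (λ m → 2 + (ι (A d e) + m)) (≡-sym (+-assoc (ι (A d f)) _ xd))))
        (degree-bound {v ∷ a ∷ e ∷ f ∷ g ∷ R} d
          ((~⇒≢ va ∷ ~⇒≢ ve ∷ ~⇒≢ vf ∷ ~⇒≢ vg ∷ v∉R) ∷ (a≢e ∷ a≢f ∷ a≢g ∷ a∉R)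
            ∷ (e≢f ∷ e≢g ∷ e∉R) ∷ (f≢g ∷ f∉R) ∷ g∉R ∷ uR))
      deg-e : 2 + (ι (A d e) + ((ι (A e f) + ι (A e g)) + xe)) ≤ 5
      deg-e = subst (_≤ 5) (≡-trans (cong₂ (λ b c → ι b + (ι c + (ι (A e d) + (ι (A e f) + (ι (A e g) + xe)))))
            (~-sym ve) (~-sym ae))
          (cong₂ (λ b m → 2 + (ι b + m)) (Graph.sym G e d) (≡-sym (+-assoc (ι (A e f)) _ xe))))
        (degree-bound {v ∷ a ∷ d ∷ f ∷ g ∷ R} e
          ((~⇒≢ va ∷ ~⇒≢ vd ∷ ~⇒≢ vf ∷ ~⇒≢ vg ∷ v∉R) ∷ (a≢d ∷ a≢f ∷ a≢g ∷ a∉R)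
            ∷ (d≢f ∷ d≢g ∷ d∉R) ∷ (f≢g ∷ f∉R) ∷ g∉R ∷ uR))

  -- The codegrees sum to 14 < 3 * 5, so some `a` has codegree at most 2, and `t≤5+codeg` makes it
  -- exactly 2: `a` sees two of the other four neighbours and misses two.
  low-neighbour : ∀ {v} → t v ≡ 7 → ∃ λ a → v ~ a × t a ≤ 5
  low-neighbour {v} t≡7 = a , va , arrange (separate (A a) rest)
    where
    6≤t : 5 < t v
    6≤t = subst (5 <_) (≡-sym t≡7) (m≤m+n 6 1)
    low = low-codeg 3 {v} 6≤t (subst (λ m → 2 * m < 15) (≡-sym t≡7) ≤-refl)
    a  = proj₁ low
    va = proj₁ (proj₂ low)
    open Extension (extend {v} {a ∷ []} ([] ∷ []) (va ∷ []))
    two : Σ[ rest ] (ι ∘ A a) ≡ 2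
    two = ≡-trans (≡-sym (≡-trans (Σ-↭ (ι ∘ A a) perm) (cong (λ e → ι e + Σ[ rest ] (ι ∘ A a)) (irrefl G a))))
      (≤-antisym (≤-pred (proj₂ (proj₂ low))) (+-cancelˡ-≤ 5 _ _ (subst (_≤ 5 + codeg a v) t≡7 (t≤5+codeg va))))
    four : length rest ≡ 4
    four = cong pred (≡-trans (≡-sym (↭-length perm)) (length-nb≡5 6≤t))
    arrange : (∃₂ λ M N → rest ↭ M ++ N × All (a ~_) M × All (a ≁_) N × length M ≡ Σ[ rest ] (ι ∘ A a)) → t a ≤ 5
    arrange (M , N , σ , a~M , a≁N , len) = go M N (≡-trans len two) (≡-trans (≡-sym (↭-length σ)) four) σ a~M a≁N
      where
      go : ∀ M N → length M ≡ 2 → length (M ++ N) ≡ 4 → rest ↭ M ++ N → All (a ~_) M → All (a ≁_) N → t a ≤ 5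
      go (d ∷ e ∷ []) (f ∷ g ∷ []) refl refl σ (ad ∷ ae ∷ []) (af ∷ ag ∷ []) =
        low-at (↭-trans perm (prep a σ)) (Unique-resp-↭ (prep a σ) unique)
          (All-resp-↭ (prep a σ) adjacent) ad ae af ag t≡7

  -- Flow of charge: bounds on what a vertex sends and receives.

  near8? : ∀ u → Dec (Any (λ y → t y ≡ 8) (nb u))
  near8? u = any? (λ y → t y ≟ℕ 8) (nb u)

  flow : V → V → ℕ
  flow u w = charge (t u) (does (near8? u)) (t w)

  inflow outflow : V → ℕ
  inflow  x = Σ[ nb x ] (λ u → flow u x)
  outflow x = Σ[ nb x ] (flow x)

  inflow-zero : ∀ {x} → (∀ {u} → x ~ u → flow u x ≡ 0) → inflow x ≡ 0
  inflow-zero h = Σ-zero (All.tabulate λ u∈ → h (nb-~ u∈))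

  rim≢8 : ∀ {v b w x y z} → Block v b w x y z → t w ≢ 8
  rim≢8 B t≡8 = contradiction (subst (_≤ 7) t≡8 (t-rim≤7 B)) (<⇒≱ ≤-refl)

  flow-from-8 : ∀ {u w} → t u ≡ 8 → t w ≢ 8 → flow u w ≡ 2
  flow-from-8 {u} {w} t≡8 w≢8 =
    ≡-trans (cong (λ p → charge p (does (near8? u)) (t w)) t≡8) (charge-from-8 (does (near8? u)) w≢8)

  -- Each of the four rim vertices of the block has t at most 7 and is sent 2.
  outflow-8 : ∀ {x} → t x ≡ 8 → 8 ≤ outflow x
  outflow-8 {x} t≡8 = let (b , _ , _ , _ , _ , B) = block t≡8 in ≤-trans
    (+-mono-≤ (z≤n {flow x b}) (+-mono-≤ (two (rim≢8 B)) (+-mono-≤ (two (rim≢8 (swap-wx B)))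
      (+-mono-≤ (two (rim≢8 (swap-pairs B))) (+-mono-≤ (two (rim≢8 (swap-pairs (swap-yz B)))) (z≤n {0}))))))
    (≤-reflexive (≡-sym (Σ-↭ (flow x) (nb-v B))))
    where
    two : ∀ {u} → t u ≢ 8 → 2 ≤ flow x u
    two u≢8 = ≤-reflexive (≡-sym (flow-from-8 t≡8 u≢8))

  -- A vertex with t at least 6 is paid only by neighbours with t = 8; around `w` these can only be
  -- the twins `v` and `b`, sending at most 2 each.
  inflow-rim : ∀ {v b w x y z} → Block v b w x y z → 6 ≤ t w → inflow w ≤ 4
  inflow-rim {v} {b} {w} {x} {y} {z} B 6≤t = go (rimNbhd B)
    where
    flow≤2 : ∀ u → flow u w ≤ 2
    flow≤2 u = charge≤2 (t u) _ (t w) λ _ w≤5 _ → contradiction w≤5 (<⇒≱ 6≤t)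
    silent : ∀ u → t u ≢ 8 → flow u w ≤ 0
    silent u u≢8 = ≤-reflexive (charge-to-heavy _ u≢8 6≤t)
    y≤0 = silent y (rim≢8 (swap-pairs B))
    z≤0 = silent z (rim≢8 (swap-pairs (swap-yz B)))
    go : RimNbhd v b w y z → inflow w ≤ 4
    go (inner p) = ≤-trans (≤-reflexive (Σ-↭ (λ u → flow u w) p))
      (+-mono-≤ (flow≤2 v) (+-mono-≤ (flow≤2 b) (+-mono-≤ y≤0 (+-mono-≤ z≤0 (z≤n {0})))))
    go (outer r p wr vr br _ _) = ≤-trans (≤-reflexive (Σ-↭ (λ u → flow u w) p))
      (+-mono-≤ (flow≤2 v) (+-mono-≤ (flow≤2 b) (+-mono-≤ y≤0 (+-mono-≤ z≤0
        (+-mono-≤ (silent r (t-outer≢8 B p wr vr br)) (z≤n {0}))))))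

  block-near : ∀ {w} → t w ≢ 8 → Any (λ y → t y ≡ 8) (nb w) →
    ∃ λ v → ∃₂ λ b x → ∃₂ λ y z → Block v b w x y z
  block-near w≢8 near =
    let (v , v∈ , t≡8) = find near in v , block-at-rim t≡8 (~-sym (nb-~ v∈)) w≢8

  inflow-far : ∀ {w} → 6 ≤ t w → ¬ Any (λ y → t y ≡ 8) (nb w) → inflow w ≡ 0
  inflow-far 6≤t far = inflow-zero λ {u} wu →
    charge-to-heavy _ (λ u≡8 → far (lose (∈-nb wu) u≡8)) 6≤t

  -- A charge of 5 comes from a rim vertex with t = 7, and by `rim-low` it only reaches vertices
  -- with t at most 4.
  flow-to-5 : ∀ {u x} → t x ≡ 5 → u ~ x → flow u x ≤ 2
  flow-to-5 {u} {x} t≡5 ux = charge≤2 (t u) _ (t x) big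
    where
    big : t u ≡ 7 → t x ≤ 5 → does (near8? u) ≡ true → Empty
    big u≡7 x≤5 h with near8? u
    ... | yes near =
      let (_ , _ , _ , _ , _ , B) = block-near (λ u≡8 → contradiction (≡-trans (≡-sym u≡7) u≡8) λ ()) near
      in contradiction (subst (_≤ 4) t≡5 (rim-low B u≡7 ux x≤5)) (<⇒≱ ≤-refl)

  -- A sender has t at least 7, hence codegree at least 2 with `x`, and pays at most 5. The
  -- codegrees sum to `2 * t x`, so there are at most `t x` senders.
  inflow-light : ∀ x → inflow x ≤ 5 * t x
  inflow-light x = *-cancelˡ-≤ 2 (begin
    2 * inflow x                             ≡⟨ ≡-sym (Σ-* 2 (nb x) _) ⟩
    Σ[ nb x ] (λ u → 2 * flow u x)           ≤⟨ Σ-mono (nb x) (λ u∈ → pay (nb-~ u∈)) ⟩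
    Σ[ nb x ] (λ u → 5 * codeg u x)          ≡⟨ Σ-* 5 (nb x) _ ⟩
    5 * Σ[ nb x ] (λ u → codeg u x)          ≡⟨ cong (5 *_) (Σ-codeg x) ⟩
    5 * (2 * t x)                            ≡⟨ ≡-trans (≡-sym (*-assoc 5 2 (t x))) (*-assoc 2 5 (t x)) ⟩
    2 * (5 * t x)                            ∎)
    where
    open ≤-Reasoning
    pay : ∀ {u} → x ~ u → 2 * flow u x ≤ 5 * codeg u x
    pay {u} xu with t u ≤? 6
    ... | yes u≤6 = ≤-trans (≤-reflexive (cong (2 *_) (charge-light _ (t x) u≤6))) z≤n
    ... | no  u≰6 = ≤-trans (*-monoʳ-≤ 2 (charge≤5 (t u) _ (t x)))
      (*-monoʳ-≤ 5 (+-cancelˡ-≤ 5 2 _ (≤-trans (≰⇒> u≰6)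
        (subst (λ c → t u ≤ 5 + c) (codeg-sym x u) (t≤5+codeg (~-sym xu))))))

  -- Final charges, by the value of t.

  balance-8 : ∀ {x} → t x ≡ 8 → 7 * t x + inflow x ≤ 48 + outflow x
  balance-8 {x} t≡8 = begin
    7 * t x + inflow x   ≡⟨ cong₂ _+_ (cong (7 *_) t≡8) (inflow-zero λ {u} _ →
                             ≡-trans (cong (charge (t u) _) t≡8) (charge-to-8 (t u) _)) ⟩
    48 + 8               ≤⟨ +-monoʳ-≤ 48 (outflow-8 t≡8) ⟩
    48 + outflow x       ∎
    where open ≤-Reasoning

  balance-7 : ∀ {x} → t x ≡ 7 → 7 * t x + inflow x ≤ 48 + outflow x
  balance-7 {x} t≡7 = pay (near8? x) refl
    where
    open ≤-Reasoning
    a = proj₁ (low-neighbour t≡7)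
    xa = proj₁ (proj₂ (low-neighbour t≡7))
    a≤5 = proj₂ (proj₂ (low-neighbour t≡7))
    x≢8 : t x ≢ 8
    x≢8 x≡8 = contradiction (≡-trans (≡-sym t≡7) x≡8) λ ()
    6≤t : 6 ≤ t x
    6≤t = subst (6 ≤_) (≡-sym t≡7) (m≤m+n 6 1)
    sends : ∀ {h} → does (near8? x) ≡ h → (if h then 5 else 1) ≤ outflow x
    sends {h} eq = ≤-trans (≤-reflexive (≡-sym (≡-trans (cong₂ (λ p h → charge p h (t a)) t≡7 eq) (charge-from-7 h a≤5))))
      (Σ-member (flow x) (∈-nb xa))
    pay : (d : Dec (Any (λ y → t y ≡ 8) (nb x))) → near8? x ≡ d → 7 * t x + inflow x ≤ 48 + outflow x
    -- Here 49 + 4 = 48 + 5: at most four units arrive, and the low neighbour `a` is sent five.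
    pay (yes near) eq = begin
      7 * t x + inflow x ≤⟨ +-mono-≤ (≤-reflexive (cong (7 *_) t≡7))
                              (let (_ , _ , _ , _ , _ , B) = block-near x≢8 near in inflow-rim B 6≤t) ⟩
      48 + 5             ≤⟨ +-monoʳ-≤ 48 (sends (cong does eq)) ⟩
      48 + outflow x     ∎
    -- Nothing arrives, and the excess 49 - 48 is the single unit sent to `a`.
    pay (no far) eq = begin
      7 * t x + inflow x ≡⟨ cong₂ _+_ (cong (7 *_) t≡7) (inflow-far 6≤t far) ⟩
      48 + 1             ≤⟨ +-monoʳ-≤ 48 (sends (cong does eq)) ⟩
      48 + outflow x     ∎

  balance-6 : ∀ {x} → t x ≡ 6 → 7 * t x + inflow x ≤ 48 + outflow x
  balance-6 {x} t≡6 = ≤-trans (+-mono-≤ (≤-reflexive (cong (7 *_) t≡6)) small) (m≤m+n 48 (outflow x))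
    where
    small : inflow x ≤ 6
    small with near8? x
    ... | no far   = ≤-trans (≤-reflexive (inflow-far (≤-reflexive (≡-sym t≡6)) far)) z≤n
    ... | yes near =
      let (_ , _ , _ , _ , _ , B) = block-near (λ x≡8 → contradiction (≡-trans (≡-sym t≡6) x≡8) λ ()) near
      in ≤-trans (inflow-rim B (≤-reflexive (≡-sym t≡6))) (m≤m+n 4 2)

  balance-5 : ∀ {x} → t x ≡ 5 → 7 * t x + inflow x ≤ 48 + outflow x
  balance-5 {x} t≡5 = ≤-trans (+-mono-≤ (≤-reflexive (cong (7 *_) t≡5)) small) (m≤m+n 48 (outflow x))
    where
    small : inflow x ≤ 13
    small = ≤-trans (Σ-mono (nb x) (λ u∈ → flow-to-5 t≡5 (~-sym (nb-~ u∈))))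
      (≤-trans (≤-reflexive (Σ-const (nb x) 2)) (≤-trans (*-monoˡ-≤ 2 (length-nb x)) (m≤m+n 10 3)))

  -- The total 7t + 5t reaches 48 exactly at t = 4.
  balance-light : ∀ {x} → t x ≤ 4 → 7 * t x + inflow x ≤ 48 + outflow x
  balance-light {x} t≤4 = ≤-trans
    (+-mono-≤ (*-monoʳ-≤ 7 t≤4) (≤-trans (inflow-light x) (*-monoʳ-≤ 5 t≤4))) (m≤m+n 48 (outflow x))

  balance : ∀ x → 7 * t x + inflow x ≤ 48 + outflow x
  balance x with m≤n⇒m<n∨m≡n (t≤8 x)
  ... | inj₂ t≡8 = balance-8 t≡8
  ... | inj₁ t<8 with m≤n⇒m<n∨m≡n (≤-pred t<8)
  ...   | inj₂ t≡7 = balance-7 t≡7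
  ...   | inj₁ t<7 with m≤n⇒m<n∨m≡n (≤-pred t<7)
  ...     | inj₂ t≡6 = balance-6 t≡6
  ...     | inj₁ t<6 with m≤n⇒m<n∨m≡n (≤-pred t<6)
  ...       | inj₂ t≡5 = balance-5 t≡5
  ...       | inj₁ t<5 = balance-light (≤-pred t<5)

  -- Summation over all vertices and the triangle bound.

  Σflow : Σ[ allFin n ] inflow ≡ Σ[ allFin n ] outflow
  Σflow = begin
    Σ[ allFin n ] inflow
      ≡⟨ Σ-cong (allFin n) (λ x → Σ-filterᵇ (A x) (allFin n) (λ u → flow u x)) ⟩
    Σ[ allFin n ] (λ x → Σ[ allFin n ] (λ u → ι (A x u) * flow u x))
      ≡⟨ Σ-swap (allFin n) (allFin n) _ ⟩
    Σ[ allFin n ] (λ u → Σ[ allFin n ] (λ x → ι (A x u) * flow u x))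
      ≡⟨ Σ-cong (allFin n) (λ u → ≡-trans
           (Σ-cong (allFin n) (λ x → cong (λ a → ι a * flow u x) (Graph.sym G x u)))
           (≡-sym (Σ-filterᵇ (A u) (allFin n) (flow u)))) ⟩
    Σ[ allFin n ] outflow ∎
    where open ≡-Reasoning

  weight-bound : 7 * Σ[ allFin n ] t ≤ 48 * n
  weight-bound = +-cancelʳ-≤ (Σ[ allFin n ] inflow) _ _ (begin
    7 * Σ[ allFin n ] t + Σ[ allFin n ] inflow
      ≡⟨ cong (_+ Σ[ allFin n ] inflow) (≡-sym (Σ-* 7 (allFin n) t)) ⟩
    Σ[ allFin n ] (λ x → 7 * t x) + Σ[ allFin n ] inflow
      ≡⟨ ≡-sym (Σ-+ (allFin n) _ _) ⟩
    Σ[ allFin n ] (λ x → 7 * t x + inflow x)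
      ≤⟨ Σ-mono (allFin n) (λ {x} _ → balance x) ⟩
    Σ[ allFin n ] (λ x → 48 + outflow x)
      ≡⟨ Σ-+ (allFin n) _ _ ⟩
    Σ[ allFin n ] (λ _ → 48) + Σ[ allFin n ] outflow
      ≡⟨ cong₂ _+_ (≡-trans (Σ-const (allFin n) 48) (≡-trans (cong (_* 48) (length-tabulate {n = n} (λ i → i))) (*-comm n 48)))
           (≡-sym Σflow) ⟩
    48 * n + Σ[ allFin n ] inflow ∎)
    where open ≤-Reasoning

  6k₃≤2Σt : 6 * k 3 G ≤ 2 * Σ[ allFin n ] t
  6k₃≤2Σt = ≤-trans (triangles≤ G) (≤-reflexive (≡-trans (Σ-cong (allFin n) link) (Σ-* 2 (allFin n) t)))
    where
    link : ∀ v → Σ[ allFin n ] (λ x → ι (A v x) * Σ[ allFin n ] (λ y → ι (A v y) * ι (A x y))) ≡ 2 * t v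
    link v = ≡-trans (≡-sym (Σ-filterᵇ (A v) (allFin n) _)) (≡-trans
      (Σ-cong (nb v) (λ x → ≡-sym (Σ-filterᵇ (A v) (allFin n) (ι ∘ A x)))) (Σ-codeg v))

  triangle-bound : 7 * k 3 G ≤ 16 * n
  triangle-bound = *-cancelˡ-≤ 6 (begin
    6 * (7 * k 3 G)              ≡⟨ ≡-trans (≡-sym (*-assoc 6 7 (k 3 G))) (*-assoc 7 6 (k 3 G)) ⟩
    7 * (6 * k 3 G)              ≤⟨ *-monoʳ-≤ 7 6k₃≤2Σt ⟩
    7 * (2 * Σ[ allFin n ] t)    ≡⟨ ≡-trans (≡-sym (*-assoc 7 2 (Σ[ allFin n ] t))) (*-assoc 2 7 (Σ[ allFin n ] t)) ⟩
    2 * (7 * Σ[ allFin n ] t)    ≤⟨ *-monoʳ-≤ 2 weight-bound ⟩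
    2 * (48 * n)                 ≡⟨ ≡-trans (≡-sym (*-assoc 2 48 n)) (*-assoc 6 16 n) ⟩
    6 * (16 * n)                 ∎)
    where
    open ≤-Reasoning

-- The extremal graph and the conclusion.

Gstar-ω : CliqueNumber≤ Gstar 4
Gstar-ω S clique with ∣ S ∣ ≤? 4
... | yes p = p
-- A larger clique is excluded by searching all 128 vertex subsets.
... | no ¬p = contradiction (S , clique , ¬p)
  (toWitnessFalse {a? = anySubset? λ S → (isCliqueᵇ Gstar S ≟ᵇ true) ×-dec ¬? (∣ S ∣ ≤? 4)} tt)

-- The limit defining f₃(5,4) is the supremum of k₃/n, so its value is 16/7 once every graph of the
-- class obeys the bound and one member attains it.
theorem6p7 : ((n : ℕ) (G : Graph n) → InClass G 5 4 → 7 * k 3 G ≤ 16 * n)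
    × InClass Gstar 5 4
    × (7 * k 3 Gstar ≡ 16 * 7)
theorem6p7 =
  (λ n G (Δ≤5 , ω≤4) → Discharging.triangle-bound G Δ≤5 ω≤4)
  , (toWitness {a? = all? λ i → degree Gstar i ≤? 5} tt , Gstar-ω)
  , refl
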